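{- Over $\mathbb{F}_4$, in $\mathbb{F}_4^5$, there exist multispreads with parameters $(51,5)_4^{3,5}$, $(36,6)_4^{3,5}$ and $(21,7)_4^{3,5}$ whose full automorphism groups have order $120$, $40$ and $7$, respectively. More precisely, there exist multisets of subspaces of $\mathbb{F}_4^5$ consisting of, respectively, (a) $17$ two-dimensional and $65$ three-dimensional subspaces, with full automorphism group of order $120$, (b) $12$ two-dimensional and $86$ three-dimensional subspaces, with full automorphism group of order $40$, (c) $7$ two-dimensional and $107$ three-dimensional subspaces, with full automorphism group of order $7$, such that in each case every hyperplane of $\mathbb{F}_4^5$ contains exactly $2$ of the subspaces (counted with multiplicity); these are multispreads with the parameters $(51,5)_4^{3,5}$, $(36,6)_4^{3,5}$, $(21,7)_4^{3,5}$, respectively.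
   Context: All dimensions are vector-space dimensions; a hyperplane of $\mathbb{F}_q^k$ is a $(k-1)$-dimensional subspace. A $(\lambda,\mu)_q^{h,k}$-multispread is a collection (multiset) $\mathcal{S}$ of subspaces of $\mathbb{F}_q^k$ of dimension at most $h$ such that $\sum_{S\in\mathcal{S},\,v\in S}q^{h-\dim S}=\mu$ for every non-zero vector $v\in\mathbb{F}_q^k$, and $\sum_{S\in\mathcal{S}}(q^{h-\dim S}-1)=\lambda$. The full automorphism group of a multiset $\mathcal{S}$ of subspaces of $\mathbb{F}_q^k$ is the group of all collineations of the projective geometry of $\mathbb{F}_q^k$ (invertible semilinear maps of $\mathbb{F}_q^k$, taken modulo non-zero scalars) that map $\mathcal{S}$ to itself, preserving multiplicities. -}

module Defs where

open import Level using (0ℓ) renaming (suc to lsuc)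
open import Algebra.Bundles using (CommutativeRing; Group; RawRing)
open import Algebra.Morphism.Structures using (module RingMorphisms)
import Algebra.Morphism.Construct.Identity as Identity
import Algebra.Morphism.Construct.Composition as Composition
open import Data.Fin.Base using (Fin)
import Data.List.Base as List
open import Data.List.Base using (List; filter)
import Data.List.Relation.Unary.All as All
import Data.List.Relation.Binary.Permutation.Setoid as Permutation
import Data.List.Relation.Binary.Permutation.Setoid.Properties as Permutationₚ
import Data.List.Relation.Binary.Pointwise as Pointwise
open import Data.Nat.Base as ℕ using (ℕ; zero; suc; _∸_; _^_; _≤_)
import Data.Nat.Properties as ℕₚ
open import Data.Product using (∃; _×_; _,_; proj₁; proj₂)
open import Data.Vec.Base as Vec using (Vec; []; _∷_; zipWith; replicate)
import Data.Vec.Properties as Vecₚ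
import Data.Vec.Relation.Unary.All as VecAll
open VecAll using ([]; _∷_)
import Data.Vec.Relation.Unary.All.Properties as VecAllₚ
open import Function.Base using (id; _∘_)
open import Function.Bundles using (Bijection)
open import Function.Definitions using (Bijective)
open import Relation.Binary.Bundles using (Setoid)
open import Relation.Binary.Definitions using (DecidableEquality)
open import Relation.Binary.PropositionalEquality
  using (_≡_; _≢_; refl; sym; trans; cong; cong₂; subst; setoid; isEquivalence; module ≡-Reasoning)
open import Relation.Nullary.Decidable using (Dec; yes; no; map′; from-yes; _×-dec_)
open import Relation.Unary using (Pred; Decidable; _≐_)

infixl 6 _+_
infixl 7 _*_

-- 𝔽₂[ω] / (ω² + ω + 1)
data 𝔽₄ : Set where
  0# 1# ω ω² : 𝔽₄

_+_ : 𝔽₄ → 𝔽₄ → 𝔽₄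
0# + y  = y
1# + 0# = 1#
1# + 1# = 0#
1# + ω  = ω²
1# + ω² = ω
ω  + 0# = ω
ω  + 1# = ω²
ω  + ω  = 0#
ω  + ω² = 1#
ω² + 0# = ω²
ω² + 1# = ω
ω² + ω  = 1#
ω² + ω² = 0#

_*_ : 𝔽₄ → 𝔽₄ → 𝔽₄
0# * y  = 0#
1# * y  = y
ω  * 0# = 0#
ω  * 1# = ω
ω  * ω  = ω²
ω  * ω² = 1#
ω² * 0# = 0#
ω² * 1# = ω²
ω² * ω  = 1#
ω² * ω² = ω

-- x³ ≡ 1 for x ≢ 0; by convention 0⁻¹ = 0.
_⁻¹ : 𝔽₄ → 𝔽₄
x ⁻¹ = x * x

infix 4 _≟_

_≟_ : DecidableEquality 𝔽₄
0# ≟ 0# = yes refl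
0# ≟ 1# = no λ ()
0# ≟ ω  = no λ ()
0# ≟ ω² = no λ ()
1# ≟ 0# = no λ ()
1# ≟ 1# = yes refl
1# ≟ ω  = no λ ()
1# ≟ ω² = no λ ()
ω  ≟ 0# = no λ ()
ω  ≟ 1# = no λ ()
ω  ≟ ω  = yes refl
ω  ≟ ω² = no λ ()
ω² ≟ 0# = no λ ()
ω² ≟ 1# = no λ ()
ω² ≟ ω  = no λ ()
ω² ≟ ω² = yes refl

all? : {P : Pred 𝔽₄ 0ℓ} → Decidable P → Dec (∀ x → P x)
all? P? = map′
  (λ { (a , b , c , d) → λ { 0# → a ; 1# → b ; ω → c ; ω² → d } })
  (λ f → f 0# , f 1# , f ω , f ω²)
  (P? 0# ×-dec P? 1# ×-dec P? ω ×-dec P? ω²)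

+-assoc : ∀ x y z → (x + y) + z ≡ x + (y + z)
+-assoc = from-yes (all? λ x → all? λ y → all? λ z → (x + y) + z ≟ x + (y + z))

+-comm : ∀ x y → x + y ≡ y + x
+-comm = from-yes (all? λ x → all? λ y → x + y ≟ y + x)

+-identityʳ : ∀ x → x + 0# ≡ x
+-identityʳ = from-yes (all? λ x → x + 0# ≟ x)

+-inverse : ∀ x → x + x ≡ 0#
+-inverse = from-yes (all? λ x → x + x ≟ 0#)

*-assoc : ∀ x y z → (x * y) * z ≡ x * (y * z)
*-assoc = from-yes (all? λ x → all? λ y → all? λ z → (x * y) * z ≟ x * (y * z))

*-comm : ∀ x y → x * y ≡ y * x
*-comm = from-yes (all? λ x → all? λ y → x * y ≟ y * x)

*-identityʳ : ∀ x → x * 1# ≡ x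
*-identityʳ = from-yes (all? λ x → x * 1# ≟ x)

*-distribˡ : ∀ x y z → x * (y + z) ≡ x * y + x * z
*-distribˡ = from-yes (all? λ x → all? λ y → all? λ z → x * (y + z) ≟ x * y + x * z)

*-distribʳ : ∀ x y z → (y + z) * x ≡ y * x + z * x
*-distribʳ = from-yes (all? λ x → all? λ y → all? λ z → (y + z) * x ≟ y * x + z * x)

*-inverseˡ : ∀ {x} → x ≢ 0# → x ⁻¹ * x ≡ 1#
*-inverseˡ {0#} x≢0 with () ← x≢0 refl
*-inverseˡ {1#} _ = refl
*-inverseˡ {ω}  _ = refl
*-inverseˡ {ω²} _ = refl

-- Negation is the identity in characteristic 2.
𝔽₄-commutativeRing : CommutativeRing 0ℓ 0ℓ
𝔽₄-commutativeRing = record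
  { Carrier = 𝔽₄ ; _≈_ = _≡_ ; _+_ = _+_ ; _*_ = _*_ ; -_ = id ; 0# = 0# ; 1# = 1#
  ; isCommutativeRing = record
    { isRing = record
      { +-isAbelianGroup = record
        { isGroup = record
          { isMonoid = record
            { isSemigroup = record
              { isMagma = record { isEquivalence = isEquivalence ; ∙-cong = cong₂ _+_ }
              ; assoc   = +-assoc }
            ; identity = (λ _ → refl) , +-identityʳ }
          ; inverse = +-inverse , +-inverse
          ; ⁻¹-cong = id }
        ; comm = +-comm }
      ; *-cong = cong₂ _*_
      ; *-assoc = *-assoc
      ; *-identity = (λ _ → refl) , *-identityʳ
      ; distrib = *-distribˡ , *-distribʳ }
    ; *-comm = *-comm } }

private
  𝔽₄-rawRing : RawRing 0ℓ 0ℓ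
  𝔽₄-rawRing = CommutativeRing.rawRing 𝔽₄-commutativeRing

open RingMorphisms 𝔽₄-rawRing 𝔽₄-rawRing using (IsRingIsomorphism)

q : ℕ
q = 4

Vector : ℕ → Set
Vector k = Vec 𝔽₄ k

private variable
  k n : ℕ

infixl 6 _⊕_
infixr 7 _·_

𝟎 : Vector k
𝟎 = replicate _ 0#

_⊕_ : Vector k → Vector k → Vector k
_⊕_ = zipWith _+_

_·_ : 𝔽₄ → Vector k → Vector k
c · v = Vec.map (c *_) v


linComb : Vec 𝔽₄ n → Vec (Vector k) n → Vector k
linComb []       []       = 𝟎
linComb (c ∷ cs) (v ∷ vs) = c · v ⊕ linComb cs vs

LinearlyIndependent : Vec (Vector k) n → Set
LinearlyIndependent vs = ∀ cs → linComb cs vs ≡ 𝟎 → cs ≡ 𝟎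

1·v≡v : (v : Vector k) → 1# · v ≡ v
1·v≡v = Vecₚ.map-id

0·v≡𝟎 : (v : Vector k) → 0# · v ≡ 𝟎
0·v≡𝟎 = λ v → Vecₚ.map-const v 0#

·-assoc : ∀ a b (v : Vector k) → (a * b) · v ≡ a · b · v
·-assoc a b []      = refl
·-assoc a b (x ∷ v) = cong₂ _∷_ (*-assoc a b x) (·-assoc a b v)

record IsSubspace (P : Pred (Vector k) 0ℓ) : Set where
  field
    𝟎∈       : P 𝟎
    ⊕-closed : ∀ {u v} → P u → P v → P (u ⊕ v)
    ·-closed : ∀ c {v} → P v → P (c · v)

record IsBasis (P : Pred (Vector k) 0ℓ) (vs : Vec (Vector k) n) : Set where
  field
    basis⊆      : VecAll.All P vs
    independent : LinearlyIndependent vs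
    spans       : ∀ {v} → P v → ∃ λ cs → v ≡ linComb cs vs

-- Subspaces are compared by their sets of vectors (see `subspaceSetoid`
-- below), so the basis, which is there to witness the dimension, does not
-- affect the equality of subspaces.
record Subspace (k : ℕ) : Set₁ where
  field
    ⟨_⟩        : Pred (Vector k) 0ℓ
    isSubspace : IsSubspace ⟨_⟩
    member?    : Decidable ⟨_⟩
    dim        : ℕ
    basis      : Vec (Vector k) dim
    isBasis    : IsBasis ⟨_⟩ basis

  open IsSubspace isSubspace public
  open IsBasis isBasis public

open Subspace public using (⟨_⟩; dim)

infix 4 _∈_ _∈?_ _⊆_ _⊆?_ _≈_

_∈_ : Vector k → Subspace k → Set
v ∈ S = ⟨ S ⟩ v

_∈?_ : (v : Vector k) (S : Subspace k) → Dec (v ∈ S)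
v ∈? S = Subspace.member? S v

_⊆_ : Subspace k → Subspace k → Set
S ⊆ T = ∀ {v} → v ∈ S → v ∈ T

linComb∈ : (S : Subspace k) (cs : Vec 𝔽₄ n) {vs : Vec (Vector k) n} →
           VecAll.All (_∈ S) vs → linComb cs vs ∈ S
linComb∈ S []       []         = Subspace.𝟎∈ S
linComb∈ S (c ∷ cs) (v∈ ∷ vs∈) = Subspace.⊕-closed S (Subspace.·-closed S c v∈) (linComb∈ S cs vs∈)

_⊆?_ : (S T : Subspace k) → Dec (S ⊆ T)
S ⊆? T = map′ basis⊆T⇒S⊆T (λ S⊆T → VecAll.map S⊆T S.basis⊆)
              (VecAll.all? (_∈? T) S.basis)
  where
  module S = Subspace S
  basis⊆T⇒S⊆T : VecAll.All (_∈ T) S.basis → S ⊆ T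
  basis⊆T⇒S⊆T bs∈T v∈S =
    let cs , v≡ = S.spans v∈S in subst (_∈ T) (sym v≡) (linComb∈ T cs bs∈T)

_≈_ : Subspace k → Subspace k → Set
S ≈ T = ⟨ S ⟩ ≐ ⟨ T ⟩

subspaceSetoid : ℕ → Setoid (lsuc 0ℓ) 0ℓ
subspaceSetoid k = record
  { Carrier = Subspace k
  ; _≈_     = _≈_
  ; isEquivalence = record
    { refl  = id , id
    ; sym   = λ (f , g) → g , f
    ; trans = λ (f , g) (f′ , g′) → f′ ∘ f , g ∘ g′ } }

IsHyperplane : Subspace k → Set
IsHyperplane {k} H = suc (dim H) ≡ k

-- Finite multisets are lists, regarded up to `_↭_`.
Multiset : ℕ → Set₁
Multiset k = List (Subspace k)

module _ {k : ℕ} where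
  open Permutation (subspaceSetoid k) public using (_↭_)

#ofDim : ℕ → Multiset k → ℕ
#ofDim d 𝓢 = List.length (filter (λ S → dim S ℕₚ.≟ d) 𝓢)

#containedIn : Subspace k → Multiset k → ℕ
#containedIn H 𝓢 = List.length (filter (_⊆? H) 𝓢)

-- q ^ (h ∸ dim S) ∸ 1 involves no truncation once all dimensions are at most h.
record IsMultispread (l μ h k : ℕ) (𝓢 : Multiset k) : Set₁ where
  field
    dim≤h    : All.All (λ S → dim S ≤ h) 𝓢
    covering : (v : Vector k) → v ≢ 𝟎 →
               List.sum (List.map (λ S → q ^ (h ∸ dim S)) (filter (v ∈?_) 𝓢)) ≡ μ
    excess   : List.sum (List.map (λ S → q ^ (h ∸ dim S) ∸ 1) 𝓢) ≡ l

record SemilinearAut (k : ℕ) : Set where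
  field
    to        : Vector k → Vector k
    σ         : 𝔽₄ → 𝔽₄
    σ-isIso   : IsRingIsomorphism σ
    to-⊕      : ∀ u v → to (u ⊕ v) ≡ to u ⊕ to v
    to-·      : ∀ c v → to (c · v) ≡ σ c · to v
    bijective : Bijective _≡_ _≡_ to

  open IsRingIsomorphism σ-isIso public
    renaming ( injective to σ-injective; surjective to σ-surjective
             ; 0#-homo to σ-0#; 1#-homo to σ-1#; +-homo to σ-+; *-homo to σ-*)
    using ()

  from : Vector k → Vector k
  from w = proj₁ (proj₂ bijective w)

  to∘from : ∀ w → to (from w) ≡ w
  to∘from w = proj₂ (proj₂ bijective w) refl

  to-injective : ∀ {u v} → to u ≡ to v → u ≡ v
  to-injective = proj₁ bijective

  from∘to : ∀ v → from (to v) ≡ v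
  from∘to v = to-injective (to∘from (to v))

  σ⁻ : 𝔽₄ → 𝔽₄
  σ⁻ c = proj₁ (σ-surjective c)

  σ∘σ⁻ : ∀ c → σ (σ⁻ c) ≡ c
  σ∘σ⁻ c = proj₂ (σ-surjective c) refl

  to-𝟎 : to 𝟎 ≡ 𝟎
  to-𝟎 = begin
    to 𝟎          ≡⟨ cong to (0·v≡𝟎 𝟎) ⟨
    to (0# · 𝟎)   ≡⟨ to-· 0# 𝟎 ⟩
    σ 0# · to 𝟎   ≡⟨ cong (_· to 𝟎) σ-0# ⟩
    0# · to 𝟎     ≡⟨ 0·v≡𝟎 (to 𝟎) ⟩
    𝟎             ∎
    where open ≡-Reasoning

  to-linComb : (cs : Vec 𝔽₄ n) (vs : Vec (Vector k) n) →
               to (linComb cs vs) ≡ linComb (Vec.map σ cs) (Vec.map to vs)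
  to-linComb []       []       = to-𝟎
  to-linComb (c ∷ cs) (v ∷ vs) =
    trans (to-⊕ _ _) (cong₂ _⊕_ (to-· c v) (to-linComb cs vs))

  map-σ∘σ⁻ : (cs : Vec 𝔽₄ n) → Vec.map σ (Vec.map σ⁻ cs) ≡ cs
  map-σ∘σ⁻ []       = refl
  map-σ∘σ⁻ (c ∷ cs) = cong₂ _∷_ (σ∘σ⁻ c) (map-σ∘σ⁻ cs)

  map-to-independent : (vs : Vec (Vector k) n) →
                       LinearlyIndependent vs → LinearlyIndependent (Vec.map to vs)
  map-to-independent {n} vs indep cs eq = begin
    cs                        ≡⟨ map-σ∘σ⁻ cs ⟨
    Vec.map σ (Vec.map σ⁻ cs) ≡⟨ cong (Vec.map σ) (indep (Vec.map σ⁻ cs) (to-injective eq′)) ⟩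
    Vec.map σ 𝟎               ≡⟨ Vecₚ.map-replicate σ 0# n ⟩
    replicate n (σ 0#)        ≡⟨ cong (replicate n) σ-0# ⟩
    𝟎                         ∎
    where
    open ≡-Reasoning
    eq′ : to (linComb (Vec.map σ⁻ cs) vs) ≡ to 𝟎
    eq′ = begin
      to (linComb (Vec.map σ⁻ cs) vs)                        ≡⟨ to-linComb (Vec.map σ⁻ cs) vs ⟩
      linComb (Vec.map σ (Vec.map σ⁻ cs)) (Vec.map to vs)    ≡⟨ cong (λ ds → linComb ds (Vec.map to vs)) (map-σ∘σ⁻ cs) ⟩
      linComb cs (Vec.map to vs)                             ≡⟨ eq ⟩
      𝟎                                                      ≡⟨ to-𝟎 ⟨
      to 𝟎                                                   ∎

module _ (f : SemilinearAut k) where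
  open SemilinearAut f

  image : Subspace k → Subspace k
  image S = record
    { ⟨_⟩        = λ w → ∃ λ v → v ∈ S × to v ≡ w
    ; isSubspace = record
      { 𝟎∈       = 𝟎 , S.𝟎∈ , to-𝟎
      ; ⊕-closed = λ { (u , u∈ , refl) (v , v∈ , refl) → u ⊕ v , S.⊕-closed u∈ v∈ , to-⊕ u v }
      ; ·-closed = λ { c (v , v∈ , refl) →
          σ⁻ c · v , S.·-closed (σ⁻ c) v∈ , trans (to-· (σ⁻ c) v) (cong (_· to v) (σ∘σ⁻ c)) } }
    ; member? = λ w → map′ (λ v∈ → from w , v∈ , to∘from w)
                           (λ { (v , v∈ , refl) → subst (_∈ S) (sym (from∘to v)) v∈ })
                           (from w ∈? S)
    ; dim     = S.dim
    ; basis   = Vec.map to S.basis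
    ; isBasis = record
      { basis⊆      = VecAllₚ.map⁺ (VecAll.map (λ {v} v∈ → v , v∈ , refl) S.basis⊆)
      ; independent = map-to-independent S.basis S.independent
      ; spans       = λ { (v , v∈ , refl) → let cs , v≡ = S.spans v∈ in
          Vec.map σ cs , trans (cong to v≡) (to-linComb cs S.basis) } } }
    where module S = Subspace S

  image-cong : {S T : Subspace k} → S ≈ T → image S ≈ image T
  image-cong (S⊆T , T⊆S) = (λ (v , v∈ , eq) → v , S⊆T v∈ , eq) , (λ (v , v∈ , eq) → v , T⊆S v∈ , eq)

idₛ : SemilinearAut k
idₛ = record
  { to = id ; σ = id
  ; σ-isIso   = Identity.isRingIsomorphism 𝔽₄-rawRing refl
  ; to-⊕      = λ _ _ → refl
  ; to-·      = λ _ _ → refl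
  ; bijective = id , λ w → w , id }

infixr 9 _∘ₛ_

_∘ₛ_ : SemilinearAut k → SemilinearAut k → SemilinearAut k
g ∘ₛ f = record
  { to = g.to ∘ f.to ; σ = g.σ ∘ f.σ
  ; σ-isIso   = Composition.isRingIsomorphism trans f.σ-isIso g.σ-isIso
  ; to-⊕      = λ u v → trans (cong g.to (f.to-⊕ u v)) (g.to-⊕ _ _)
  ; to-·      = λ c v → trans (cong g.to (f.to-· c v)) (g.to-· _ _)
  ; bijective = (f.to-injective ∘ g.to-injective)
              , λ w → f.from (g.from w)
                    , λ { refl → trans (cong g.to (f.to∘from _)) (g.to∘from w) } }
  where
  module f = SemilinearAut f
  module g = SemilinearAut g

invₛ : SemilinearAut k → SemilinearAut k
invₛ f = record
  { to = from ; σ = σ⁻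
  ; σ-isIso = record
    { isRingMonomorphism = record
      { isRingHomomorphism = record
        { isSemiringHomomorphism = record
          { isNearSemiringHomomorphism = record
            { +-isMonoidHomomorphism = record
              { isMagmaHomomorphism = record
                { isRelHomomorphism = record { cong = cong σ⁻ }
                ; homo = λ a b → σ-injective (trans (σ∘σ⁻ _)
                    (sym (trans (σ-+ _ _) (cong₂ _+_ (σ∘σ⁻ a) (σ∘σ⁻ b))))) }
              ; ε-homo = σ-injective (trans (σ∘σ⁻ _) (sym σ-0#)) }
            ; *-homo = λ a b → σ-injective (trans (σ∘σ⁻ _)
                (sym (trans (σ-* _ _) (cong₂ _*_ (σ∘σ⁻ a) (σ∘σ⁻ b))))) }
          ; 1#-homo = σ-injective (trans (σ∘σ⁻ _) (sym σ-1#)) }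
        ; -‿homo = λ _ → refl }
      ; injective = λ {a} {b} eq → trans (sym (σ∘σ⁻ a)) (trans (cong σ eq) (σ∘σ⁻ b)) }
    ; surjective = λ c → σ c , λ { refl → σ-injective (σ∘σ⁻ (σ c)) } }
  ; to-⊕ = λ u v → to-injective (trans (to∘from _)
      (sym (trans (to-⊕ _ _) (cong₂ _⊕_ (to∘from u) (to∘from v)))))
  ; to-· = λ c v → to-injective (trans (to∘from _)
      (sym (trans (to-· _ _) (cong₂ _·_ (σ∘σ⁻ c) (to∘from v)))))
  ; bijective = (λ {u} {v} eq → trans (sym (to∘from u)) (trans (cong to eq) (to∘from v)))
              , λ v → to v , λ { refl → from∘to v } }
  where open SemilinearAut f

infix 4 _∼_

-- Equality of collineations, i.e. modulo non-zero scalars. The companion field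
-- automorphism σ is not compared: it is determined by `to` when k > 0.
_∼_ : SemilinearAut k → SemilinearAut k → Set
f ∼ g = ∃ λ c → c ≢ 0# × (∀ v → SemilinearAut.to f v ≡ c · SemilinearAut.to g v)

1≢0 : 1# ≢ 0#
1≢0 ()

⁻¹-≢0 : ∀ {c} → c ≢ 0# → c ⁻¹ ≢ 0#
⁻¹-≢0 {0#} c≢0 _ = c≢0 refl
⁻¹-≢0 {1#} _ ()
⁻¹-≢0 {ω}  _ ()
⁻¹-≢0 {ω²} _ ()

*-≢0 : ∀ {a b} → a ≢ 0# → b ≢ 0# → a * b ≢ 0#
*-≢0 {a} {b} a≢0 b≢0 ab≡0 = b≢0 (begin
  b              ≡⟨ cong (_* b) (*-inverseˡ a≢0) ⟨
  a ⁻¹ * a * b   ≡⟨ *-assoc (a ⁻¹) a b ⟩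
  a ⁻¹ * (a * b) ≡⟨ cong (a ⁻¹ *_) ab≡0 ⟩
  a ⁻¹ * 0#      ≡⟨ *-comm (a ⁻¹) 0# ⟩
  0#             ∎)
  where open ≡-Reasoning

⁻¹-·-cancel : ∀ {c} → c ≢ 0# → {u v : Vector k} → u ≡ c · v → v ≡ c ⁻¹ · u
⁻¹-·-cancel {c = c} c≢0 {u} {v} u≡cv = begin
  v                ≡⟨ 1·v≡v v ⟨
  1# · v           ≡⟨ cong (_· v) (*-inverseˡ c≢0) ⟨
  (c ⁻¹ * c) · v   ≡⟨ ·-assoc (c ⁻¹) c v ⟩
  c ⁻¹ · c · v     ≡⟨ cong (c ⁻¹ ·_) u≡cv ⟨
  c ⁻¹ · u         ∎
  where open ≡-Reasoning

∼-refl : {f : SemilinearAut k} → f ∼ f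
∼-refl = 1# , 1≢0 , λ _ → sym (1·v≡v _)

∼-reflexive : {f g : SemilinearAut k} →
              (∀ v → SemilinearAut.to f v ≡ SemilinearAut.to g v) → f ∼ g
∼-reflexive f≗g = 1# , 1≢0 , λ v → trans (f≗g v) (sym (1·v≡v _))

∼-sym : {f g : SemilinearAut k} → f ∼ g → g ∼ f
∼-sym (c , c≢0 , eq) = c ⁻¹ , ⁻¹-≢0 c≢0 , λ v → ⁻¹-·-cancel c≢0 (eq v)

∼-trans : {f g h : SemilinearAut k} → f ∼ g → g ∼ h → f ∼ h
∼-trans (c , c≢0 , eq) (d , d≢0 , eq′) =
  c * d , *-≢0 c≢0 d≢0 , λ v → trans (eq v) (trans (cong (c ·_) (eq′ v)) (sym (·-assoc c d _)))

σ-≢0 : (f : SemilinearAut k) → ∀ {c} → c ≢ 0# → SemilinearAut.σ f c ≢ 0#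
σ-≢0 f c≢0 σc≡0 = c≢0 (σ-injective (trans σc≡0 (sym σ-0#)))
  where open SemilinearAut f

∘ₛ-cong : {g g′ f f′ : SemilinearAut k} → g ∼ g′ → f ∼ f′ → g ∘ₛ f ∼ g′ ∘ₛ f′
∘ₛ-cong {g = g} {g′} {f} {f′} (c , c≢0 , eq) (d , d≢0 , eq′) =
  c * g′.σ d , *-≢0 c≢0 (σ-≢0 g′ d≢0) , λ v → begin
    g.to (f.to v)                      ≡⟨ eq (f.to v) ⟩
    c · g′.to (f.to v)                 ≡⟨ cong (λ w → c · g′.to w) (eq′ v) ⟩
    c · g′.to (d · f′.to v)            ≡⟨ cong (c ·_) (g′.to-· d (f′.to v)) ⟩
    c · g′.σ d · g′.to (f′.to v)       ≡⟨ ·-assoc c (g′.σ d) _ ⟨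
    (c * g′.σ d) · g′.to (f′.to v)     ∎
  where
  open ≡-Reasoning
  module g  = SemilinearAut g
  module g′ = SemilinearAut g′
  module f  = SemilinearAut f
  module f′ = SemilinearAut f′

invₛ-cong : {f g : SemilinearAut k} → f ∼ g → invₛ f ∼ invₛ g
invₛ-cong {f = f} {g} f∼g@(c , c≢0 , eq) =
  g.σ⁻ d , σ-≢0 (invₛ g) (⁻¹-≢0 c≢0) , λ w → begin
    f.from w                       ≡⟨ g.from∘to (f.from w) ⟨
    g.from (g.to (f.from w))       ≡⟨ cong g.from (eq⁻ (f.from w)) ⟩
    g.from (d · f.to (f.from w))   ≡⟨ cong (λ u → g.from (d · u)) (f.to∘from w) ⟩
    g.from (d · w)                 ≡⟨ SemilinearAut.to-· (invₛ g) d w ⟩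
    g.σ⁻ d · g.from w              ∎
  where
  open ≡-Reasoning
  module f = SemilinearAut f
  module g = SemilinearAut g
  d = c ⁻¹
  eq⁻ = proj₂ (proj₂ (∼-sym {f = f} {g} f∼g))

module _ {k : ℕ} where
  open Permutation (subspaceSetoid k) using (↭-refl; ↭-sym; ↭-trans; ↭-reflexive-≋)
  open Permutationₚ using (map⁺)

  infix 4 _Preserves_

  _Preserves_ : SemilinearAut k → Multiset k → Set₁
  f Preserves 𝓢 = List.map (image f) 𝓢 ↭ 𝓢

  private
    map-↭ : (f : SemilinearAut k) {𝓢 𝓣 : Multiset k} → 𝓢 ↭ 𝓣 →
            List.map (image f) 𝓢 ↭ List.map (image f) 𝓣
    map-↭ f = map⁺ (subspaceSetoid k) (subspaceSetoid k) (λ {S} {T} → image-cong f {S} {T})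

  id-preserves : ∀ 𝓢 → idₛ Preserves 𝓢
  id-preserves 𝓢 = ↭-reflexive-≋ (lemma 𝓢)
    where
    lemma : ∀ 𝓣 → Pointwise.Pointwise _≈_ (List.map (image idₛ) 𝓣) 𝓣
    lemma List.[]      = Pointwise.[]
    lemma (S List.∷ 𝓣) =
      ((λ { (v , v∈ , refl) → v∈ }) , (λ {v} v∈ → v , v∈ , refl)) Pointwise.∷ lemma 𝓣

  ∘-preserves : ∀ g f 𝓢 → g Preserves 𝓢 → f Preserves 𝓢 → (g ∘ₛ f) Preserves 𝓢
  ∘-preserves g f 𝓢 pg pf = ↭-trans (↭-reflexive-≋ (lemma 𝓢)) (↭-trans (map-↭ g pf) pg)
    where
    lemma : ∀ 𝓣 → Pointwise.Pointwise _≈_ (List.map (image (g ∘ₛ f)) 𝓣)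
                                          (List.map (image g) (List.map (image f) 𝓣))
    lemma List.[]      = Pointwise.[]
    lemma (S List.∷ 𝓣) =
      ( (λ { (v , v∈ , eq) → _ , (v , v∈ , refl) , eq })
      , (λ { (_ , (v , v∈ , refl) , eq) → v , v∈ , eq })) Pointwise.∷ lemma 𝓣

  inv-preserves : ∀ f 𝓢 → f Preserves 𝓢 → invₛ f Preserves 𝓢
  inv-preserves f 𝓢 pf = ↭-trans (map-↭ (invₛ f) (↭-sym pf)) (↭-reflexive-≋ (lemma 𝓢))
    where
    open SemilinearAut f
    lemma : ∀ 𝓣 → Pointwise.Pointwise _≈_ (List.map (image (invₛ f)) (List.map (image f) 𝓣)) 𝓣
    lemma List.[]      = Pointwise.[]
    lemma (S List.∷ 𝓣) =
      ( (λ { (_ , (v , v∈ , refl) , refl) → subst (_∈ S) (sym (from∘to v)) v∈ })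
      , (λ {v} v∈ → to v , (v , v∈ , refl) , from∘to v)) Pointwise.∷ lemma 𝓣

record Automorphism (𝓢 : Multiset k) : Set₁ where
  field
    map       : SemilinearAut k
    preserves : map Preserves 𝓢

Aut : Multiset k → Group (lsuc 0ℓ) 0ℓ
Aut {k} 𝓢 = record
  { Carrier = Automorphism 𝓢
  ; _≈_     = λ f g → map f ∼ map g
  ; _∙_     = λ g f → record { map = map g ∘ₛ map f
                             ; preserves = ∘-preserves (map g) (map f) 𝓢 (preserves g) (preserves f) }
  ; ε       = record { map = idₛ ; preserves = id-preserves 𝓢 }
  ; _⁻¹     = λ f → record { map = invₛ (map f) ; preserves = inv-preserves (map f) 𝓢 (preserves f) }
  ; isGroup = record
    { isMonoid = record
      { isSemigroup = record
        { isMagma = record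
          { isEquivalence = record
            { refl  = λ {f} → ∼-refl {f = map f}
            ; sym   = λ {f} {g} → ∼-sym {f = map f} {map g}
            ; trans = λ {f} {g} {h} → ∼-trans {f = map f} {map g} {map h} }
          ; ∙-cong = λ {g} {g′} {f} {f′} → ∘ₛ-cong {g = map g} {map g′} {map f} {map f′} }
        ; assoc = λ h g f → ∼-refl {f = (map h ∘ₛ map g) ∘ₛ map f} }
      ; identity = (λ f → ∼-refl {f = map f}) , (λ f → ∼-refl {f = map f}) }
    ; inverse = (λ f → ∼-reflexive {f = invₛ (map f) ∘ₛ map f} {idₛ} (SemilinearAut.from∘to (map f)))
              , (λ f → ∼-reflexive {f = map f ∘ₛ invₛ (map f)} {idₛ} (SemilinearAut.to∘from (map f)))
    ; ⁻¹-cong = λ {f} {g} → invₛ-cong {f = map f} {map g} } }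
  where open Automorphism

HasOrder : ∀ {a ℓ} → Group a ℓ → ℕ → Set _
HasOrder G n = Bijection (setoid (Fin n)) (Group.setoid G)

{-# OPTIONS --safe #-}

-- Taking annihilators turns 𝓢 into a multiset of planes and lines of PG(4,4) covering every
-- point exactly twice. With a prescribed group these are exact covers of the point orbits,
-- and the orbit representatives below come from solving such exact cover problems. For (a)
-- and (b) the 2-dimensional members are points of a conic in PG(2,16), regarded as lines
-- over 𝔽₄ and projected from an 𝔽₄-point of the nucleus.
--
-- An automorphism of 𝓢 permutes a distinguished set of lines. Any two of these lines span a
-- hyperplane, which meets a third line in a point, and a depth-first search over the images
-- of the lines, pruned by the coincidences among such points, leaves few permutations. Some
-- of the points form a frame, so that a collineation is determined by its action on the
-- lines up to the Frobenius map with respect to that frame. Each of the finitely many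
-- collineations that remain either is one of the listed automorphisms, up to scalars, or
-- moves a member of 𝓢 outside 𝓢.
module Submission where

open import Defs
import Algebra.Morphism.Construct.Identity as Identity
open import Algebra.Bundles using (CommutativeRing; Group)
open import Algebra.Morphism.Structures using (module RingMorphisms)
open import Data.Bool.Base using (Bool; true; false; T; _∧_; _∨_)
import Data.Bool.Properties as Boolₚ
open import Data.Fin.Base using (Fin; zero; suc; combine; remQuot)
open import Data.Fin using (#_)
import Data.Fin.Properties as Finₚ
open import Data.List.Base as List using (List; []; _∷_; _++_)
open import Data.List.Membership.Propositional.Properties using (∈-lookup)
import Data.List.Membership.Setoid as Membership
import Data.List.Properties as Listₚ
import Data.List.Relation.Binary.Permutation.Setoid as Permutation
import Data.List.Relation.Binary.Permutation.Setoid.Properties as Permutationₚ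
open import Data.List.Relation.Unary.All as All using (All; []; _∷_)
open import Data.List.Relation.Unary.AllPairs as AllPairs using (AllPairs; []; _∷_)
import Data.List.Relation.Unary.AllPairs.Properties as AllPairsₚ
open import Data.List.Relation.Unary.Any as Any using (Any; here; there)
import Data.List.Relation.Unary.Any.Properties as Anyₚ
open import Data.Maybe using (to-witness-T)
open import Data.Maybe.Base as Maybe using (Maybe; just; nothing; is-just; _>>=_)
open import Data.Nat.Base as ℕ using (ℕ; zero; suc; _<_; _∸_; _^_; s≤s; z≤n)
open import Data.Nat.ListAction using (sum)
import Data.Nat.Properties as ℕₚ
open import Data.Product using (∃; _×_; _,_; proj₁; proj₂; map₁; map₂)
open import Data.Sum using (_⊎_; inj₁; inj₂)
open import Data.Unit.Base using (⊤; tt)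
open import Data.Vec.Base as Vec using (Vec; []; _∷_)
import Data.Vec.Properties as Vecₚ
open import Data.Vec.Relation.Binary.Pointwise.Inductive as Pointwise using (Pointwise; []; _∷_)
open import Data.Vec.Relation.Unary.All as VecAll using ([]; _∷_)
import Data.Vec.Relation.Unary.All.Properties as VecAllₚ
open import Function.Base using (_∘_; id; case_of_)
open import Function.Bundles using (_⇔_; mk⇔)
open import Level using (0ℓ)
open import Relation.Binary.Definitions using (DecidableEquality)
open import Relation.Binary.PropositionalEquality
  using (_≡_; _≢_; refl; sym; trans; cong; cong₂; subst; subst₂; module ≡-Reasoning)
open import Relation.Nullary using (¬_; contradiction)
open import Relation.Nullary.Decidable
  using (Dec; yes; no; does; map′; from-yes; ¬?; does-⇔; _×-dec_; _⊎-dec_; _→-dec_)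
open import Relation.Unary using (Pred; Decidable)

open ≡-Reasoning
open SemilinearAut

private variable
  k n d m : ℕ

-- Vectors over 𝔽₄

infix 4 _≟ᵛ_

_≟ᵛ_ : DecidableEquality (Vector k)
_≟ᵛ_ = Vecₚ.≡-dec _≟_

-- The finite verifications are stated as `does a? ≡ true` and proved by `refl`, so that checking
-- them evaluates only a Boolean.
witness : ∀ {a} {A : Set a} (a? : Dec A) → does a? ≡ true → A
witness (yes a) _ = a

allVectors? : ∀ n {P : Pred (Vector n) 0ℓ} → Decidable P → Dec (∀ v → P v)
allVectors? zero    P? = map′ (λ { p [] → p }) (λ p → p []) (P? [])
allVectors? (suc n) P? = map′ (λ { p (x ∷ v) → p x v }) (λ p x v → p (x ∷ v))
                              (all? λ x → allVectors? n (λ v → P? (x ∷ v)))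

anyVector? : ∀ n {P : Pred (Vector n) 0ℓ} → Decidable P → Dec (∃ P)
anyVector? zero    P? = map′ ([] ,_) (λ { ([] , p) → p }) (P? [])
anyVector? (suc n) {P} P? = map′
  (λ { (inj₁ (v , p)) → 0# ∷ v , p
     ; (inj₂ (inj₁ (v , p))) → 1# ∷ v , p
     ; (inj₂ (inj₂ (inj₁ (v , p)))) → ω ∷ v , p
     ; (inj₂ (inj₂ (inj₂ (v , p)))) → ω² ∷ v , p })
  (λ { (0# ∷ v , p) → inj₁ (v , p)
     ; (1# ∷ v , p) → inj₂ (inj₁ (v , p))
     ; (ω  ∷ v , p) → inj₂ (inj₂ (inj₁ (v , p)))
     ; (ω² ∷ v , p) → inj₂ (inj₂ (inj₂ (v , p))) })
  (first? 0# ⊎-dec first? 1# ⊎-dec first? ω ⊎-dec first? ω²)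
  where
  first? : ∀ x → Dec (∃ λ v → P (x ∷ v))
  first? x = anyVector? n (λ v → P? (x ∷ v))

+-interchange : ∀ a b c d → (a + b) + (c + d) ≡ (a + c) + (b + d)
+-interchange = from-yes (all? λ a → all? λ b → all? λ c → all? λ d →
  (a + b) + (c + d) ≟ (a + c) + (b + d))

*-zeroʳ : ∀ x → x * 0# ≡ 0#
*-zeroʳ = from-yes (all? λ x → x * 0# ≟ 0#)

⊕-assoc : (u v w : Vector k) → (u ⊕ v) ⊕ w ≡ u ⊕ (v ⊕ w)
⊕-assoc = Vecₚ.zipWith-assoc +-assoc

⊕-identityˡ : (v : Vector k) → 𝟎 ⊕ v ≡ v
⊕-identityˡ = Vecₚ.zipWith-identityˡ (λ _ → refl)

⊕-identityʳ : (v : Vector k) → v ⊕ 𝟎 ≡ v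
⊕-identityʳ = Vecₚ.zipWith-identityʳ +-identityʳ

⊕-self : (v : Vector k) → v ⊕ v ≡ 𝟎
⊕-self []      = refl
⊕-self (x ∷ v) = cong₂ _∷_ (+-inverse x) (⊕-self v)

⊕-interchange : (a b c d : Vector k) → (a ⊕ b) ⊕ (c ⊕ d) ≡ (a ⊕ c) ⊕ (b ⊕ d)
⊕-interchange []      []      []      []      = refl
⊕-interchange (x ∷ a) (y ∷ b) (z ∷ c) (w ∷ d) =
  cong₂ _∷_ (+-interchange x y z w) (⊕-interchange a b c d)

⊕-cancel : (u v : Vector k) → u ⊕ (u ⊕ v) ≡ v
⊕-cancel u v = trans (sym (⊕-assoc u u v)) (trans (cong (_⊕ v) (⊕-self u)) (⊕-identityˡ v))

⊕≡𝟎⇒≡ : (u v : Vector k) → u ⊕ v ≡ 𝟎 → u ≡ v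
⊕≡𝟎⇒≡ u v eq = trans (sym (⊕-identityʳ u)) (trans (cong (u ⊕_) (sym eq)) (⊕-cancel u v))

·-distribˡ : ∀ c (u v : Vector k) → c · (u ⊕ v) ≡ c · u ⊕ c · v
·-distribˡ c []      []      = refl
·-distribˡ c (x ∷ u) (y ∷ v) = cong₂ _∷_ (*-distribˡ c x y) (·-distribˡ c u v)

·-distribʳ : ∀ a b (v : Vector k) → (a + b) · v ≡ a · v ⊕ b · v
·-distribʳ a b []      = refl
·-distribʳ a b (x ∷ v) = cong₂ _∷_ (*-distribʳ x a b) (·-distribʳ a b v)

·-comm : ∀ a b (v : Vector k) → a · b · v ≡ b · a · v
·-comm a b v = trans (sym (·-assoc a b v)) (trans (cong (_· v) (*-comm a b)) (·-assoc b a v))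

·-𝟎 : ∀ c → c · 𝟎 {k} ≡ 𝟎
·-𝟎 {k} c = trans (Vecₚ.map-replicate (c *_) 0# k) (cong (Vec.replicate k) (*-zeroʳ c))

linComb-⊕ : (cs ds : Vec 𝔽₄ n) (vs : Vec (Vector k) n) →
            linComb (cs ⊕ ds) vs ≡ linComb cs vs ⊕ linComb ds vs
linComb-⊕ []       []       []       = sym (⊕-self 𝟎)
linComb-⊕ (c ∷ cs) (d ∷ ds) (v ∷ vs) =
  trans (cong₂ _⊕_ (·-distribʳ c d v) (linComb-⊕ cs ds vs)) (⊕-interchange _ _ _ _)

linComb-· : ∀ c (cs : Vec 𝔽₄ n) (vs : Vec (Vector k) n) →
            linComb (c · cs) vs ≡ c · linComb cs vs
linComb-· c []       []       = sym (·-𝟎 c)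
linComb-· c (a ∷ cs) (v ∷ vs) =
  trans (cong₂ _⊕_ (·-assoc c a v) (linComb-· c cs vs)) (sym (·-distribˡ c _ _))

linComb-map-· : ∀ c (cs : Vec 𝔽₄ n) (vs : Vec (Vector k) n) →
                linComb cs (Vec.map (c ·_) vs) ≡ c · linComb cs vs
linComb-map-· c []       []       = sym (·-𝟎 c)
linComb-map-· c (a ∷ cs) (v ∷ vs) =
  trans (cong₂ _⊕_ (·-comm a c v) (linComb-map-· c cs vs)) (sym (·-distribˡ c _ _))

linComb-𝟎 : (vs : Vec (Vector k) n) → linComb 𝟎 vs ≡ 𝟎
linComb-𝟎 []       = refl
linComb-𝟎 (v ∷ vs) = trans (cong₂ _⊕_ (0·v≡𝟎 v) (linComb-𝟎 vs)) (⊕-self 𝟎)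

linComb-linComb : (cs : Vec 𝔽₄ n) (ds : Vec (Vector d) n) (vs : Vec (Vector k) d) →
                  linComb (linComb cs ds) vs ≡ linComb cs (Vec.map (λ d → linComb d vs) ds)
linComb-linComb []       []       vs = linComb-𝟎 vs
linComb-linComb (c ∷ cs) (d ∷ ds) vs =
  trans (linComb-⊕ (c · d) (linComb cs ds) vs)
        (cong₂ _⊕_ (linComb-· c d vs) (linComb-linComb cs ds vs))

linComb-0∷ : (cs : Vec 𝔽₄ n) (vs : Vec (Vector k) n) →
             linComb cs (Vec.map (0# ∷_) vs) ≡ 0# ∷ linComb cs vs
linComb-0∷ []       []       = refl
linComb-0∷ (c ∷ cs) (v ∷ vs) =
  trans (cong (c · (0# ∷ v) ⊕_) (linComb-0∷ cs vs))
        (cong (_∷ (c · v ⊕ linComb cs vs)) (trans (+-identityʳ (c * 0#)) (*-zeroʳ c)))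

units : ∀ k → Vec (Vector k) k
units zero    = []
units (suc k) = (1# ∷ 𝟎) ∷ Vec.map (0# ∷_) (units k)

linComb-units : (v : Vector k) → linComb v (units k) ≡ v
linComb-units []      = refl
linComb-units (x ∷ v) =
  trans (cong (x · (1# ∷ 𝟎) ⊕_) (trans (linComb-0∷ v (units _)) (cong (0# ∷_) (linComb-units v))))
        (cong₂ _∷_ (trans (+-identityʳ _) (*-identityʳ x))
                   (trans (cong (_⊕ v) (·-𝟎 x)) (⊕-identityˡ v)))

infix 8 _∙_

_∙_ : Vector k → Vector k → 𝔽₄
[]      ∙ []      = 0#
(x ∷ u) ∙ (y ∷ v) = x * y + u ∙ v

∙-⊕ˡ : (u v w : Vector k) → (u ⊕ v) ∙ w ≡ u ∙ w + v ∙ w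
∙-⊕ˡ []      []      []      = refl
∙-⊕ˡ (x ∷ u) (y ∷ v) (z ∷ w) =
  trans (cong₂ _+_ (*-distribʳ z x y) (∙-⊕ˡ u v w)) (+-interchange (x * z) (y * z) (u ∙ w) (v ∙ w))

∙-⊕ʳ : (u v w : Vector k) → u ∙ (v ⊕ w) ≡ u ∙ v + u ∙ w
∙-⊕ʳ []      []      []      = refl
∙-⊕ʳ (x ∷ u) (y ∷ v) (z ∷ w) =
  trans (cong₂ _+_ (*-distribˡ x y z) (∙-⊕ʳ u v w)) (+-interchange (x * y) (x * z) (u ∙ v) (u ∙ w))

∙-·ʳ : ∀ c (u v : Vector k) → u ∙ (c · v) ≡ c * u ∙ v
∙-·ʳ c []      []      = sym (*-zeroʳ c)
∙-·ʳ c (x ∷ u) (y ∷ v) =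
  trans (cong₂ _+_ (trans (sym (*-assoc x c y)) (trans (cong (_* y) (*-comm x c)) (*-assoc c x y)))
                   (∙-·ʳ c u v))
        (sym (*-distribˡ c _ _))

∙-𝟎ʳ : (u : Vector k) → u ∙ 𝟎 ≡ 0#
∙-𝟎ʳ []      = refl
∙-𝟎ʳ (x ∷ u) = trans (cong₂ _+_ (*-zeroʳ x) (∙-𝟎ʳ u)) refl

_Annihilates_ : Vector k → Vec (Vector k) n → Set
φ Annihilates vs = VecAll.All (λ v → φ ∙ v ≡ 0#) vs

annihilates? : (φ : Vector k) (vs : Vec (Vector k) n) → Dec (φ Annihilates vs)
annihilates? φ = VecAll.all? (λ v → φ ∙ v ≟ 0#)

∙-linComb : (φ : Vector k) (cs : Vec 𝔽₄ n) {vs : Vec (Vector k) n} →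
            φ Annihilates vs → φ ∙ linComb cs vs ≡ 0#
∙-linComb φ []       []       = ∙-𝟎ʳ φ
∙-linComb φ (c ∷ cs) (p ∷ ps) =
  trans (∙-⊕ʳ φ _ _)
        (cong₂ _+_ (trans (∙-·ʳ c φ _) (trans (cong (c *_) p) (*-zeroʳ c))) (∙-linComb φ cs ps))

-- Dimension counting

private
  toFin : 𝔽₄ → Fin 4
  toFin 0# = zero
  toFin 1# = suc zero
  toFin ω  = suc (suc zero)
  toFin ω² = suc (suc (suc zero))

  fromFin : Fin 4 → 𝔽₄
  fromFin zero                   = 0#
  fromFin (suc zero)             = 1#
  fromFin (suc (suc zero))       = ω
  fromFin (suc (suc (suc zero))) = ω²

  toFin-fromFin : ∀ i → toFin (fromFin i) ≡ i
  toFin-fromFin zero                   = refl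
  toFin-fromFin (suc zero)             = refl
  toFin-fromFin (suc (suc zero))       = refl
  toFin-fromFin (suc (suc (suc zero))) = refl

  fromFin-toFin : ∀ x → fromFin (toFin x) ≡ x
  fromFin-toFin = from-yes (all? λ x → fromFin (toFin x) ≟ x)

  index : Vector k → Fin (q ^ k)
  index []      = zero
  index (x ∷ v) = combine (toFin x) (index v)

  unindex : ∀ k → Fin (q ^ k) → Vector k
  unindex zero    _ = []
  unindex (suc k) i = fromFin (proj₁ (remQuot {q} (q ^ k) i)) ∷ unindex k (proj₂ (remQuot {q} (q ^ k) i))

  index-injective : (u v : Vector k) → index u ≡ index v → u ≡ v
  index-injective []      []      _  = refl
  index-injective (x ∷ u) (y ∷ v) eq =
    let eq₁ , eq₂ = Finₚ.combine-injective (toFin x) (index u) (toFin y) (index v) eq in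
    cong₂ _∷_ (trans (sym (fromFin-toFin x)) (trans (cong fromFin eq₁) (fromFin-toFin y)))
              (index-injective u v eq₂)

  index-unindex : ∀ k i → index (unindex k i) ≡ i
  index-unindex zero    zero = refl
  index-unindex (suc k) i    =
    let j , l = remQuot {q} (q ^ k) i in
    trans (cong₂ combine (toFin-fromFin j) (index-unindex k l)) (Finₚ.combine-remQuot {q} (q ^ k) i)

-- Pigeonhole: two of the `q ^ n` arguments share one of the `q ^ k` values, and their sum, which in
-- characteristic 2 is their difference, lies in the kernel.
∃-kernel : k < n → (L : Vector n → Vector k) → (∀ u v → L (u ⊕ v) ≡ L u ⊕ L v) →
           ∃ λ x → x ≢ 𝟎 × L x ≡ 𝟎
∃-kernel {k} {n} k<n L L-⊕
  with i , j , i<j , eq ← Finₚ.pigeonhole (ℕₚ.^-monoʳ-< q (s≤s (s≤s z≤n)) k<n) (index ∘ L ∘ unindex n)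
  = u ⊕ v
  , (λ u⊕v≡𝟎 → Finₚ.<⇒≢ i<j (begin
      i       ≡⟨ index-unindex n i ⟨
      index u ≡⟨ cong index (⊕≡𝟎⇒≡ u v u⊕v≡𝟎) ⟩
      index v ≡⟨ index-unindex n j ⟩
      j       ∎))
  , (begin
      L (u ⊕ v)   ≡⟨ L-⊕ u v ⟩
      L u ⊕ L v   ≡⟨ cong (_⊕ L v) (index-injective (L u) (L v) eq) ⟩
      L v ⊕ L v   ≡⟨ ⊕-self (L v) ⟩
      𝟎           ∎)
  where
  u = unindex n i
  v = unindex n j

-- If `S` had the larger dimension, the coordinate vectors of its basis over the basis of `T` would
-- satisfy a nontrivial linear relation, and so would the basis of `S` itself.
dim-mono : (S T : Subspace k) → S ⊆ T → dim S ℕ.≤ dim T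
dim-mono S T S⊆T with dim S ℕₚ.≤? dim T
... | yes dS≤dT = dS≤dT
... | no  dS≰dT = contradiction (S.independent cs (begin
    linComb cs S.basis                                   ≡⟨ cong (linComb cs) (map-coordinates S.basis⊆) ⟨
    linComb cs (Vec.map (λ ds → linComb ds T.basis) A)   ≡⟨ linComb-linComb cs A T.basis ⟨
    linComb (linComb cs A) T.basis                       ≡⟨ cong (λ ds → linComb ds T.basis) Acs≡𝟎 ⟩
    linComb 𝟎 T.basis                                    ≡⟨ linComb-𝟎 T.basis ⟩
    𝟎                                                    ∎)) cs≢𝟎
  where
  module S = Subspace S
  module T = Subspace T
  coordinates : ∀ {vs : Vec _ n} → VecAll.All (_∈ S) vs → Vec (Vector T.dim) n
  coordinates []       = []
  coordinates (p ∷ ps) = proj₁ (T.spans (S⊆T p)) ∷ coordinates ps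
  map-coordinates : ∀ {vs : Vec _ n} (ps : VecAll.All (_∈ S) vs) →
                    Vec.map (λ ds → linComb ds T.basis) (coordinates ps) ≡ vs
  map-coordinates []       = refl
  map-coordinates (p ∷ ps) = cong₂ _∷_ (sym (proj₂ (T.spans (S⊆T p)))) (map-coordinates ps)
  A = coordinates S.basis⊆
  kernel = ∃-kernel (ℕₚ.≰⇒> dS≰dT) (λ cs → linComb cs A) (λ u v → linComb-⊕ u v A)
  cs = proj₁ kernel
  cs≢𝟎 = proj₁ (proj₂ kernel)
  Acs≡𝟎 = proj₂ (proj₂ kernel)

dim-cong : {S T : Subspace k} → S ≈ T → dim S ≡ dim T
dim-cong {S = S} {T} (S⊆T , T⊆S) = ℕₚ.≤-antisym (dim-mono S T S⊆T) (dim-mono T S T⊆S)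

-- Hyperplanes

∃-nonzero : (φ : Vector k) → φ ≢ 𝟎 → ∃ λ u → φ ∙ u ≢ 0#
∃-nonzero []      φ≢𝟎 = contradiction refl φ≢𝟎
∃-nonzero (x ∷ φ) φ≢𝟎 with x ≟ 0#
... | no  x≢0  = 1# ∷ 𝟎 , λ eq → x≢0 (trans (sym (trans (cong₂ _+_ (*-identityʳ x) (∙-𝟎ʳ φ)) (+-identityʳ x))) eq)
... | yes refl = let u , φu≢0 = ∃-nonzero φ (λ φ≡𝟎 → φ≢𝟎 (cong (0# ∷_) φ≡𝟎)) in 0# ∷ u , φu≢0

scaled≡𝟎 : ∀ {c} {v w : Vector k} → c ≢ 0# → c · v ⊕ w ≡ 𝟎 → v ≡ c ⁻¹ · w
scaled≡𝟎 c≢0 eq = ⁻¹-·-cancel c≢0 (sym (⊕≡𝟎⇒≡ _ _ eq))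

*≡0 : ∀ {a b} → b ≢ 0# → a * b ≡ 0# → a ≡ 0#
*≡0 {a} b≢0 ab≡0 with a ≟ 0#
... | yes a≡0 = a≡0
... | no  a≢0 = contradiction ab≡0 (*-≢0 a≢0 b≢0)

module _ (H : Subspace k) (isHyperplane : IsHyperplane H) where
  private
    module H = Subspace H

    -- The basis of `H` imposes one linear condition fewer than `φ` has coordinates.
    kernel : ∃ λ φ → φ ≢ 𝟎 × Vec.map (φ ∙_) H.basis ≡ 𝟎
    kernel = ∃-kernel (ℕₚ.≤-reflexive isHyperplane) (λ φ → Vec.map (φ ∙_) H.basis) (map-∙ H.basis)
      where
      map-∙ : (vs : Vec (Vector k) n) (φ ψ : Vector k) →
              Vec.map ((φ ⊕ ψ) ∙_) vs ≡ Vec.map (φ ∙_) vs ⊕ Vec.map (ψ ∙_) vs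
      map-∙ []       φ ψ = refl
      map-∙ (v ∷ vs) φ ψ = cong₂ _∷_ (∙-⊕ˡ φ ψ v) (map-∙ vs φ ψ)

  normal : Vector k
  normal = proj₁ kernel

  normal≢𝟎 : normal ≢ 𝟎
  normal≢𝟎 = proj₁ (proj₂ kernel)

  private
    annihilatesBasis : normal Annihilates H.basis
    annihilatesBasis = lemma H.basis (proj₂ (proj₂ kernel))
      where
      lemma : (vs : Vec (Vector k) n) → Vec.map (normal ∙_) vs ≡ 𝟎 → normal Annihilates vs
      lemma []       _  = []
      lemma (v ∷ vs) eq = Vecₚ.∷-injectiveˡ eq ∷ lemma vs (Vecₚ.∷-injectiveʳ eq)

  ∈⇒normal : ∀ {v} → v ∈ H → normal ∙ v ≡ 0#
  ∈⇒normal v∈H = let cs , v≡ = H.spans v∈H in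
    trans (cong (normal ∙_) v≡) (∙-linComb normal cs annihilatesBasis)

  -- If v lay outside H, then v, a basis of H and a vector off the kernel of the
  -- normal would be k + 1 independent vectors.
  normal⇒∈ : ∀ {v} → normal ∙ v ≡ 0# → v ∈ H
  normal⇒∈ {v} φv≡0 = solve dependence
    where
    u = proj₁ (∃-nonzero normal normal≢𝟎)
    φu≢0 = proj₂ (∃-nonzero normal normal≢𝟎)

    dependence : ∃ λ cs → cs ≢ 𝟎 × linComb cs (u ∷ v ∷ H.basis) ≡ 𝟎
    dependence = ∃-kernel (ℕₚ.≤-reflexive (cong suc (sym isHyperplane)))
      (λ cs → linComb cs (u ∷ v ∷ H.basis)) (λ cs ds → linComb-⊕ cs ds (u ∷ v ∷ H.basis))

    drop₀ : ∀ {x w : Vector k} → 0# · x ⊕ w ≡ 𝟎 → w ≡ 𝟎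
    drop₀ {x} {w} p = trans (sym (trans (cong (_⊕ w) (0·v≡𝟎 x)) (⊕-identityˡ w))) p

    -- The normal vanishes on `v` and on the basis of `H`, so applying it to the relation leaves
    -- only `a * normal ∙ u`.
    a≡0 : ∀ a b cs → linComb (a ∷ b ∷ cs) (u ∷ v ∷ H.basis) ≡ 𝟎 → a ≡ 0#
    a≡0 a b cs eq = *≡0 {a} φu≢0 (begin
      a * normal ∙ u
        ≡⟨ ∙-·ʳ a normal u ⟨
      normal ∙ (a · u)
        ≡⟨ +-identityʳ _ ⟨
      normal ∙ (a · u) + 0#
        ≡⟨ cong (normal ∙ (a · u) +_) (∙-linComb normal (b ∷ cs) (φv≡0 ∷ annihilatesBasis)) ⟨
      normal ∙ (a · u) + normal ∙ linComb (b ∷ cs) (v ∷ H.basis)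
        ≡⟨ ∙-⊕ʳ normal (a · u) _ ⟨
      normal ∙ linComb (a ∷ b ∷ cs) (u ∷ v ∷ H.basis)
        ≡⟨ cong (normal ∙_) eq ⟩
      normal ∙ 𝟎
        ≡⟨ ∙-𝟎ʳ normal ⟩
      0# ∎)

    solve : (∃ λ cs → cs ≢ 𝟎 × linComb cs (u ∷ v ∷ H.basis) ≡ 𝟎) → v ∈ H
    solve (a ∷ b ∷ cs , cs≢𝟎 , eq) with refl ← a≡0 a b cs eq with b ≟ 0#
    ... | yes refl = contradiction (cong (λ ds → 0# ∷ 0# ∷ ds) (H.independent cs (drop₀ (drop₀ eq)))) cs≢𝟎
    ... | no  b≢0  = subst (_∈ H) (sym (scaled≡𝟎 b≢0 (drop₀ eq)))
                       (H.·-closed (b ⁻¹) (linComb∈ H cs H.basis⊆))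

  -- Replaces hyperplanes, whose membership predicates are arbitrary, by nonzero covectors, of which
  -- there are finitely many.
  #containedIn≡ : (𝓢 : Multiset k) →
    #containedIn H 𝓢 ≡ List.length (List.filter (λ S → annihilates? normal (Subspace.basis S)) 𝓢)
  #containedIn≡ 𝓢 = cong List.length (Listₚ.filter-≐ (_⊆? H) (λ S → annihilates? normal (Subspace.basis S))
    ( (λ {S} S⊆H → VecAll.map (λ v∈S → ∈⇒normal (S⊆H v∈S)) (Subspace.basis⊆ S))
    , (λ {S} ann {v} v∈S → let cs , v≡ = Subspace.spans S v∈S in
         normal⇒∈ (trans (cong (normal ∙_) v≡) (∙-linComb normal cs ann)))) 𝓢)

-- Subspaces in echelon form

-- The rows need not be reduced, so a subspace has several echelon forms.
data Echelon : ℕ → ℕ → Set where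
  []    : Echelon 0 0
  skip  : Echelon k d → Echelon (suc k) d
  pivot : Vector k → Echelon k d → Echelon (suc k) (suc d)

rows : Echelon k d → Vec (Vector k) d
rows []          = []
rows (skip E)    = Vec.map (0# ∷_) (rows E)
rows (pivot w E) = (1# ∷ w) ∷ Vec.map (0# ∷_) (rows E)

infix 4 _∈ᴱ_ _∈ᴱ?_

-- Gaussian elimination as a membership test: in a pivot column, `x` times the pivot row is
-- subtracted, which in characteristic 2 means adding `x · w` to the remaining coordinates.
_∈ᴱ_ : Vector k → Echelon k d → Set
v       ∈ᴱ []        = ⊤
(x ∷ v) ∈ᴱ skip E    = x ≡ 0# × v ∈ᴱ E
(x ∷ v) ∈ᴱ pivot w E = x · w ⊕ v ∈ᴱ E

_∈ᴱ?_ : (v : Vector k) (E : Echelon k d) → Dec (v ∈ᴱ E)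
v       ∈ᴱ? []        = yes tt
(x ∷ v) ∈ᴱ? skip E    = x ≟ 0# ×-dec v ∈ᴱ? E
(x ∷ v) ∈ᴱ? pivot w E = x · w ⊕ v ∈ᴱ? E

∈ᴱ-𝟎 : (E : Echelon k d) → 𝟎 ∈ᴱ E
∈ᴱ-𝟎 []          = tt
∈ᴱ-𝟎 (skip E)    = refl , ∈ᴱ-𝟎 E
∈ᴱ-𝟎 (pivot w E) = subst (_∈ᴱ E) (sym (trans (⊕-identityʳ _) (0·v≡𝟎 w))) (∈ᴱ-𝟎 E)

∈ᴱ-⊕ : (E : Echelon k d) (u v : Vector k) → u ∈ᴱ E → v ∈ᴱ E → u ⊕ v ∈ᴱ E
∈ᴱ-⊕ []          []      []      _          _          = tt
∈ᴱ-⊕ (skip E)    (x ∷ u) (y ∷ v) (refl , p) (refl , r) = refl , ∈ᴱ-⊕ E u v p r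
∈ᴱ-⊕ (pivot w E) (x ∷ u) (y ∷ v) p          r          =
  subst (_∈ᴱ E) (trans (⊕-interchange (x · w) u (y · w) v) (cong (_⊕ (u ⊕ v)) (sym (·-distribʳ x y w))))
        (∈ᴱ-⊕ E (x · w ⊕ u) (y · w ⊕ v) p r)

∈ᴱ-· : (E : Echelon k d) (c : 𝔽₄) (v : Vector k) → v ∈ᴱ E → c · v ∈ᴱ E
∈ᴱ-· []          c []      _          = tt
∈ᴱ-· (skip E)    c (x ∷ v) (refl , p) = *-zeroʳ c , ∈ᴱ-· E c v p
∈ᴱ-· (pivot w E) c (x ∷ v) p          =
  subst (_∈ᴱ E) (trans (·-distribˡ c (x · w) v) (cong (_⊕ c · v) (sym (·-assoc c x w))))
        (∈ᴱ-· E c (x · w ⊕ v) p)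

rows∈ : (E : Echelon k d) → VecAll.All (_∈ᴱ E) (rows E)
rows∈ []          = []
rows∈ (skip E)    = VecAllₚ.map⁺ (VecAll.map (refl ,_) (rows∈ E))
rows∈ (pivot w E) =
  subst (_∈ᴱ E) (sym (trans (cong (_⊕ w) (1·v≡v w)) (⊕-self w))) (∈ᴱ-𝟎 E) ∷
  VecAllₚ.map⁺ (VecAll.map (λ {v} → subst (_∈ᴱ E) (sym (trans (cong (_⊕ v) (0·v≡𝟎 w)) (⊕-identityˡ v)))) (rows∈ E))

linComb-pivot : ∀ c (cs : Vector d) (w : Vector k) (E : Echelon k d) →
                linComb (c ∷ cs) (rows (pivot w E)) ≡ c ∷ (c · w ⊕ linComb cs (rows E))
linComb-pivot c cs w E =
  trans (cong (c · (1# ∷ w) ⊕_) (linComb-0∷ cs (rows E)))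
        (cong (_∷ (c · w ⊕ linComb cs (rows E))) (trans (+-identityʳ (c * 1#)) (*-identityʳ c)))

rows-independent : (E : Echelon k d) → LinearlyIndependent (rows E)
rows-independent []          []       _  = refl
rows-independent (skip E)    cs       eq =
  rows-independent E cs (Vecₚ.∷-injectiveʳ (trans (sym (linComb-0∷ cs (rows E))) eq))
rows-independent (pivot w E) (c ∷ cs) eq with eq′ ← trans (sym (linComb-pivot c cs w E)) eq
  with refl ← Vecₚ.∷-injectiveˡ eq′ =
  cong (0# ∷_) (rows-independent E cs
    (trans (sym (trans (cong (_⊕ linComb cs (rows E)) (0·v≡𝟎 w)) (⊕-identityˡ _))) (Vecₚ.∷-injectiveʳ eq′)))

rows-span : (E : Echelon k d) (v : Vector k) → v ∈ᴱ E → ∃ λ cs → v ≡ linComb cs (rows E)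
rows-span []          []      _          = [] , refl
rows-span (skip E)    (x ∷ v) (refl , p) =
  map₂ (λ {cs} eq → trans (cong (0# ∷_) eq) (sym (linComb-0∷ cs (rows E)))) (rows-span E v p)
rows-span (pivot w E) (x ∷ v) p          =
  let cs , eq = rows-span E (x · w ⊕ v) p in
  x ∷ cs , trans (cong (x ∷_) (trans (sym (⊕-cancel (x · w) v)) (cong (x · w ⊕_) eq)))
                 (sym (linComb-pivot x cs w E))

⟦_⟧ : Echelon k d → Subspace k
⟦_⟧ {d = d} E = record
  { ⟨_⟩        = _∈ᴱ E
  ; isSubspace = record { 𝟎∈ = ∈ᴱ-𝟎 E ; ⊕-closed = ∈ᴱ-⊕ E _ _ ; ·-closed = λ c → ∈ᴱ-· E c _ }
  ; member?    = _∈ᴱ? E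
  ; dim        = d
  ; basis      = rows E
  ; isBasis    = record { basis⊆ = rows∈ E ; independent = rows-independent E ; spans = rows-span E _ } }

-- The dimension is existentially quantified since it grows only when the new vector lies outside
-- the span.
insert : Vector k → ∃ (Echelon k) → ∃ (Echelon k)
insert []      E                   = E
insert (x ∷ v) (_ , skip E)        with x ≟ 0#
... | yes _ = map₂ skip (insert v (_ , E))
... | no  _ = _ , pivot (x ⁻¹ · v) E
insert (x ∷ v) (_ , pivot w E)     = let _ , E′ = insert (x · w ⊕ v) (_ , E) in _ , pivot w E′

zeroSpace : ∀ k → Echelon k 0
zeroSpace zero    = []
zeroSpace (suc k) = skip (zeroSpace k)

echelon : List (Vector k) → ∃ (Echelon k)
echelon = List.foldr insert (_ , zeroSpace _)

⟪_⟫ : List (Vector k) → Subspace k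
⟪ vs ⟫ = ⟦ proj₂ (echelon vs) ⟧

-- Semilinear maps given by matrices

private
  𝔽₄-rawRing = CommutativeRing.rawRing 𝔽₄-commutativeRing

open RingMorphisms 𝔽₄-rawRing 𝔽₄-rawRing using (IsRingIsomorphism)

data FieldAut : Set where
  identity frobenius : FieldAut

applyF : FieldAut → 𝔽₄ → 𝔽₄
applyF identity  x = x
applyF frobenius x = x * x

applyF-isIso : ∀ s → IsRingIsomorphism (applyF s)
applyF-isIso identity  = Identity.isRingIsomorphism 𝔽₄-rawRing refl
applyF-isIso frobenius = record
  { isRingMonomorphism = record
    { isRingHomomorphism = record
      { isSemiringHomomorphism = record
        { isNearSemiringHomomorphism = record
          { +-isMonoidHomomorphism = record
            { isMagmaHomomorphism = record
              { isRelHomomorphism = record { cong = cong (applyF frobenius) }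
              ; homo = from-yes (all? λ x → all? λ y → (x + y) * (x + y) ≟ x * x + y * y) }
            ; ε-homo = refl }
          ; *-homo = from-yes (all? λ x → all? λ y → (x * y) * (x * y) ≟ (x * x) * (y * y)) }
        ; 1#-homo = refl }
      ; -‿homo = λ _ → refl }
    ; injective = λ {x} {y} eq → trans (sym (involutive x)) (trans (cong (applyF frobenius) eq) (involutive y)) }
  ; surjective = λ y → y * y , λ { refl → involutive y } }
  where
  involutive : ∀ x → (x * x) * (x * x) ≡ x
  involutive = from-yes (all? λ x → (x * x) * (x * x) ≟ x)

-- Matrices are given by their columns.
Matrix : ℕ → Set
Matrix k = Vec (Vector k) k

apply : FieldAut → Matrix k → Vector k → Vector k
apply s M v = linComb (Vec.map (applyF s) v) M

module _ (s : FieldAut) where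
  open IsRingIsomorphism (applyF-isIso s)

  map-applyF-⊕ : (u v : Vector k) → Vec.map (applyF s) (u ⊕ v) ≡ Vec.map (applyF s) u ⊕ Vec.map (applyF s) v
  map-applyF-⊕ []      []      = refl
  map-applyF-⊕ (x ∷ u) (y ∷ v) = cong₂ _∷_ (+-homo x y) (map-applyF-⊕ u v)

  map-applyF-· : ∀ c (v : Vector k) → Vec.map (applyF s) (c · v) ≡ applyF s c · Vec.map (applyF s) v
  map-applyF-· c []      = refl
  map-applyF-· c (x ∷ v) = cong₂ _∷_ (*-homo c x) (map-applyF-· c v)

-- The same `s` serves for both directions, as both automorphisms of 𝔽₄ are their own inverses.
Inverses : FieldAut → Matrix k → Matrix k → Set
Inverses s M N = ∀ v → apply s M (apply s N v) ≡ v × apply s N (apply s M v) ≡ v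

inverses? : ∀ s (M N : Matrix k) → Dec (Inverses s M N)
inverses? s M N = allVectors? _ λ v →
  (apply s M (apply s N v) ≟ᵛ v) ×-dec (apply s N (apply s M v) ≟ᵛ v)

matrixAut : ∀ s (M N : Matrix k) → does (inverses? s M N) ≡ true → SemilinearAut k
matrixAut s M N inverse = record
  { to        = apply s M
  ; σ         = applyF s
  ; σ-isIso   = applyF-isIso s
  ; to-⊕      = λ u v → trans (cong (λ cs → linComb cs M) (map-applyF-⊕ s u v))
                              (linComb-⊕ (Vec.map (applyF s) u) (Vec.map (applyF s) v) M)
  ; to-·      = λ c v → trans (cong (λ cs → linComb cs M) (map-applyF-· s c v))
                              (linComb-· (applyF s c) (Vec.map (applyF s) v) M)
  ; bijective = (λ {u} {v} eq → trans (sym (NM u)) (trans (cong (apply s N) eq) (NM v)))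
              , λ w → apply s N w , λ { refl → MN w } }
  where
  MN : ∀ v → apply s M (apply s N v) ≡ v
  MN v = proj₁ (witness (inverses? s M N) inverse v)
  NM : ∀ v → apply s N (apply s M v) ≡ v
  NM v = proj₂ (witness (inverses? s M N) inverse v)

-- Equality of collineations

σ-cong : (f g : SemilinearAut k) → σ f ω ≡ σ g ω → ∀ x → σ f x ≡ σ g x
σ-cong f g eq 0# = trans (σ-0# f) (sym (σ-0# g))
σ-cong f g eq 1# = trans (σ-1# f) (sym (σ-1# g))
σ-cong f g eq ω  = eq
σ-cong f g eq ω² = trans (σ-* f ω ω) (trans (cong₂ _*_ eq eq) (sym (σ-* g ω ω)))

unitImages : SemilinearAut k → Vec (Vector k) k
unitImages f = Vec.map (to f) (units _)

to-via-units : (f : SemilinearAut k) (v : Vector k) → to f v ≡ linComb (Vec.map (σ f) v) (unitImages f)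
to-via-units f v = trans (cong (to f) (sym (linComb-units v))) (to-linComb f v (units _))

Proportional : (us vs : Vec (Vector k) n) → Set
Proportional us vs = ∃ λ c → c ≢ 0# × us ≡ Vec.map (c ·_) vs

proportional? : (us vs : Vec (Vector k) n) → Dec (Proportional us vs)
proportional? us vs = map′
  (λ { (inj₁ eq) → 1# , (λ ()) , eq
     ; (inj₂ (inj₁ eq)) → ω , (λ ()) , eq
     ; (inj₂ (inj₂ eq)) → ω² , (λ ()) , eq })
  (λ { (0# , 0≢0 , _) → contradiction refl 0≢0
     ; (1# , _ , eq) → inj₁ eq
     ; (ω  , _ , eq) → inj₂ (inj₁ eq)
     ; (ω² , _ , eq) → inj₂ (inj₂ eq) })
  (by? 1# ⊎-dec by? ω ⊎-dec by? ω²)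
  where
  by? : ∀ c → Dec (us ≡ Vec.map (c ·_) vs)
  by? c = Vecₚ.≡-dec _≟ᵛ_ us (Vec.map (c ·_) vs)

-- A semilinear map is determined by its field automorphism and the images of the unit vectors, and
-- the former by its value at `ω`. This makes `∼` checkable on finite data.
proportional⇒∼ : (f g : SemilinearAut k) → σ f ω ≡ σ g ω →
                 Proportional (unitImages f) (unitImages g) → f ∼ g
proportional⇒∼ f g σ≡ (c , c≢0 , eq) = c , c≢0 , λ v → begin
  to f v
    ≡⟨ to-via-units f v ⟩
  linComb (Vec.map (σ f) v) (unitImages f)
    ≡⟨ cong₂ linComb (Vecₚ.map-cong (σ-cong f g σ≡) v) eq ⟩
  linComb (Vec.map (σ g) v) (Vec.map (c ·_) (unitImages g))
    ≡⟨ linComb-map-· c (Vec.map (σ g) v) (unitImages g) ⟩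
  c · linComb (Vec.map (σ g) v) (unitImages g)
    ≡⟨ cong (c ·_) (to-via-units g v) ⟨
  c · to g v ∎

∼⇒proportional : (f g : SemilinearAut k) → f ∼ g → Proportional (unitImages f) (unitImages g)
∼⇒proportional f g (c , c≢0 , eq) =
  c , c≢0 , trans (Vecₚ.map-cong eq (units _)) (Vecₚ.map-∘ (c ·_) (to g) (units _))

∼-∘-involution : (f h β : SemilinearAut k) → (∀ v → to β (to β v) ≡ v) →
                 invₛ f ∘ₛ h ∼ β → f ∼ h ∘ₛ β
∼-∘-involution f h β involutive (c , c≢0 , eq) = ∼-sym {f = h ∘ₛ β} {f}
  (σ f c , σ-≢0 f c≢0 , λ v → begin
    to h (to β v)                  ≡⟨ to∘from f (to h (to β v)) ⟨
    to f (from f (to h (to β v)))  ≡⟨ cong (to f) (eq (to β v)) ⟩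
    to f (c · to β (to β v))       ≡⟨ cong (λ w → to f (c · w)) (involutive v) ⟩
    to f (c · v)                   ≡⟨ to-· f c v ⟩
    σ f c · to f v                 ∎)

-- Both `h` and `h ∘ₛ β` are kept because fixing a frame does not decide the field automorphism.
twists : SemilinearAut k → List (SemilinearAut k) → List (SemilinearAut k)
twists β hs = hs ++ List.map (_∘ₛ β) hs

any-twists : (f β : SemilinearAut k) {hs : List (SemilinearAut k)} →
             Any (λ h → f ∼ h ⊎ f ∼ h ∘ₛ β) hs → Any (f ∼_) (twists β hs)
any-twists f β {hs} p with Anyₚ.Any-⊎⁻ p
... | inj₁ q = Anyₚ.++⁺ˡ q
... | inj₂ q = Anyₚ.++⁺ʳ hs (Anyₚ.map⁺ q)

-- Collineations fixing a frame

Fixes : SemilinearAut k → Vector k → Set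
Fixes f v = ∃ λ c → to f v ≡ c · v

𝟏 : Vector k
𝟏 = Vec.replicate _ 1#

zipWith-*-𝟏 : (as : Vector k) → Vec.zipWith _*_ 𝟏 as ≡ as
zipWith-*-𝟏 = Vecₚ.zipWith-identityˡ (λ _ → refl)

linComb-zipWith-· : (cs as : Vec 𝔽₄ n) (vs : Vec (Vector k) n) →
                    linComb cs (Vec.zipWith _·_ as vs) ≡ linComb (Vec.zipWith _*_ cs as) vs
linComb-zipWith-· []       []       []       = refl
linComb-zipWith-· (c ∷ cs) (a ∷ as) (v ∷ vs) =
  cong₂ _⊕_ (sym (·-assoc c a v)) (linComb-zipWith-· cs as vs)

map-replicate-· : ∀ c (vs : Vec (Vector k) n) → Vec.zipWith _·_ (Vec.replicate n c) vs ≡ Vec.map (c ·_) vs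
map-replicate-· c []       = refl
map-replicate-· c (v ∷ vs) = cong (c · v ∷_) (map-replicate-· c vs)

-- The unit vectors are eigenvectors with eigenvalues `as`, so `𝟏` is sent to the vector `as`
-- itself; since this is a multiple of `𝟏`, all eigenvalues agree.
fixes-frame : (f : SemilinearAut (suc k)) → VecAll.All (Fixes f) (units (suc k)) → Fixes f 𝟏 →
              ∃ λ c → c ≢ 0# × (∀ v → to f v ≡ c · Vec.map (σ f) v)
fixes-frame {k} f fixesUnits (c , f𝟏≡c𝟏) = c , c≢0 , toScalar
  where
  eigenvalues : ∀ {vs : Vec (Vector (suc k)) n} → VecAll.All (Fixes f) vs →
                ∃ λ as → Vec.map (to f) vs ≡ Vec.zipWith _·_ as vs
  eigenvalues []              = [] , refl
  eigenvalues ((a , eq) ∷ ps) = let as , eqs = eigenvalues ps in a ∷ as , cong₂ _∷_ eq eqs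

  as   = proj₁ (eigenvalues fixesUnits)
  f≡as = proj₂ (eigenvalues fixesUnits)

  σ𝟏≡𝟏 : Vec.map (σ f) 𝟏 ≡ 𝟏
  σ𝟏≡𝟏 = trans (Vecₚ.map-replicate (σ f) 1# (suc k)) (cong (Vec.replicate _) (σ-1# f))

  as≡c : as ≡ Vec.replicate _ c
  as≡c = begin
    as                                                  ≡⟨ zipWith-*-𝟏 as ⟨
    Vec.zipWith _*_ 𝟏 as                                ≡⟨ linComb-units _ ⟨
    linComb (Vec.zipWith _*_ 𝟏 as) (units _)            ≡⟨ linComb-zipWith-· 𝟏 as (units _) ⟨
    linComb 𝟏 (Vec.zipWith _·_ as (units _))            ≡⟨ cong₂ linComb σ𝟏≡𝟏 f≡as ⟨
    linComb (Vec.map (σ f) 𝟏) (unitImages f)            ≡⟨ to-via-units f 𝟏 ⟨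
    to f 𝟏                                              ≡⟨ f𝟏≡c𝟏 ⟩
    c · 𝟏                                               ≡⟨ Vecₚ.map-replicate (c *_) 1# (suc k) ⟩
    Vec.replicate _ (c * 1#)                            ≡⟨ cong (Vec.replicate _) (*-identityʳ c) ⟩
    Vec.replicate _ c                                   ∎

  toScalar : ∀ v → to f v ≡ c · Vec.map (σ f) v
  toScalar v = begin
    to f v
      ≡⟨ to-via-units f v ⟩
    linComb (Vec.map (σ f) v) (unitImages f)
      ≡⟨ cong (linComb (Vec.map (σ f) v)) (trans f≡as (cong (λ as → Vec.zipWith _·_ as (units _)) as≡c)) ⟩
    linComb (Vec.map (σ f) v) (Vec.zipWith _·_ (Vec.replicate _ c) (units _))
      ≡⟨ cong (linComb (Vec.map (σ f) v)) (map-replicate-· c (units _)) ⟩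
    linComb (Vec.map (σ f) v) (Vec.map (c ·_) (units _))
      ≡⟨ linComb-map-· c (Vec.map (σ f) v) (units _) ⟩
    c · linComb (Vec.map (σ f) v) (units _)
      ≡⟨ cong (c ·_) (linComb-units (Vec.map (σ f) v)) ⟩
    c · Vec.map (σ f) v ∎

  c≢0 : c ≢ 0#
  c≢0 refl = contradiction (cong Vec.head (to-injective f {𝟏} {𝟎} (begin
    to f 𝟏                    ≡⟨ toScalar 𝟏 ⟩
    0# · Vec.map (σ f) 𝟏      ≡⟨ 0·v≡𝟎 (Vec.map (σ f) 𝟏) ⟩
    𝟎                         ≡⟨ to-𝟎 f ⟨
    to f 𝟎                    ∎))) λ ()

σ-cases : (f : SemilinearAut k) → (∀ x → σ f x ≡ x) ⊎ (∀ x → σ f x ≡ applyF frobenius x)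
σ-cases f with σ f ω in eq
... | 0# = contradiction eq (σ-≢0 f (λ ()))
... | 1# = contradiction (σ-injective f (trans eq (sym (σ-1# f)))) (λ ())
... | ω  = inj₁ λ { 0# → σ-0# f ; 1# → σ-1# f ; ω → eq ; ω² → trans (σ-* f ω ω) (cong₂ _*_ eq eq) }
... | ω² = inj₂ λ { 0# → σ-0# f ; 1# → σ-1# f ; ω → eq ; ω² → trans (σ-* f ω ω) (cong₂ _*_ eq eq) }

frobeniusAut : SemilinearAut 5
frobeniusAut = matrixAut frobenius (units 5) (units 5) refl

frobeniusAut-involutive : ∀ v → to frobeniusAut (to frobeniusAut v) ≡ v
frobeniusAut-involutive v = to∘from frobeniusAut v

module Frame (B : SemilinearAut 5) where

  frame : Vec (Vector 5) 6
  frame = Vec.map (to B) (𝟏 ∷ units 5)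

  -- The Frobenius map in the coordinates defined by `frame`.
  conjugation : SemilinearAut 5
  conjugation = B ∘ₛ frobeniusAut ∘ₛ invₛ B

  conjugation-involutive : ∀ v → to conjugation (to conjugation v) ≡ v
  conjugation-involutive v = begin
    to B (to frobeniusAut (from B (to B (to frobeniusAut (from B v)))))
      ≡⟨ cong (to B ∘ to frobeniusAut) (from∘to B _) ⟩
    to B (to frobeniusAut (to frobeniusAut (from B v)))
      ≡⟨ cong (to B) (frobeniusAut-involutive (from B v)) ⟩
    to B (from B v)
      ≡⟨ to∘from B v ⟩
    v ∎

  -- Conjugating by `B` moves the frame to the standard one, where `fixes-frame` leaves a scalar
  -- times a field automorphism, and 𝔽₄ has just two of these.
  fixing-frame : (g : SemilinearAut 5) → VecAll.All (Fixes g) frame → g ∼ idₛ ⊎ g ∼ conjugation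
  fixing-frame g fixes with VecAllₚ.map⁻ fixes
  ... | fix𝟏 ∷ fixUnits = cases (fixes-frame f (VecAll.map fixed fixUnits) (fixed fix𝟏))
    where
    f : SemilinearAut 5
    f = invₛ B ∘ₛ g ∘ₛ B

    fixed : ∀ {v} → Fixes g (to B v) → Fixes f v
    fixed {v} (c , eq) = σ⁻ B c , trans (cong (from B) eq)
      (trans (SemilinearAut.to-· (invₛ B) c (to B v)) (cong (σ⁻ B c ·_) (from∘to B v)))

    transfer : ∀ {h} → f ∼ h → g ∼ B ∘ₛ h ∘ₛ invₛ B
    transfer {h} (c , c≢0 , eq) = σ B c , σ-≢0 B c≢0 , λ v → begin
      to g v                              ≡⟨ cong (to g) (to∘from B v) ⟨
      to g (to B (from B v))              ≡⟨ to∘from B _ ⟨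
      to B (to f (from B v))              ≡⟨ cong (to B) (eq (from B v)) ⟩
      to B (c · to h (from B v))          ≡⟨ to-· B c _ ⟩
      σ B c · to B (to h (from B v))      ∎

    cases : (∃ λ c → c ≢ 0# × (∀ v → to f v ≡ c · Vec.map (σ f) v)) → g ∼ idₛ ⊎ g ∼ conjugation
    cases (c , c≢0 , eq) with σ-cases f
    ... | inj₁ σ≗ = inj₁ (∼-trans {f = g} {B ∘ₛ idₛ ∘ₛ invₛ B} {idₛ}
      (transfer {idₛ} (c , c≢0 , λ v → trans (eq v) (cong (c ·_) (trans (Vecₚ.map-cong σ≗ v) (Vecₚ.map-id v)))))
      (∼-reflexive {f = B ∘ₛ idₛ ∘ₛ invₛ B} {idₛ} (to∘from B)))
    ... | inj₂ σ≗ = inj₂ (transfer {frobeniusAut} (c , c≢0 , λ v → trans (eq v)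
      (cong (c ·_) (trans (Vecₚ.map-cong σ≗ v) (sym (linComb-units _))))))

-- Systems of lines

-- One vector for each of the five points of PG(1,4); through `pt` they run over the points of a
-- line.
slopes : List (Vector 2)
slopes = (0# ∷ 1# ∷ []) ∷ (1# ∷ 0# ∷ []) ∷ (1# ∷ 1# ∷ []) ∷ (1# ∷ ω ∷ []) ∷ (1# ∷ ω² ∷ []) ∷ []

slopes-nonzero : All (_≢ 𝟎) slopes
slopes-nonzero = (λ ()) ∷ (λ ()) ∷ (λ ()) ∷ (λ ()) ∷ (λ ()) ∷ []

slope : ∀ c → c ≢ 𝟎 → ∃ λ s → Any (s · c ≡_) slopes
slope (x ∷ y ∷ []) c≢𝟎 with x ≟ 0#
... | no  x≢0  = x ⁻¹ , Any.map (trans (cong (_∷ (x ⁻¹ * y) ∷ []) (*-inverseˡ x≢0))) (1∷ (x ⁻¹ * y))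
  where
  1∷ : ∀ z → Any ((1# ∷ z ∷ []) ≡_) slopes
  1∷ 0# = there (here refl)
  1∷ 1# = there (there (here refl))
  1∷ ω  = there (there (there (here refl)))
  1∷ ω² = there (there (there (there (here refl))))
... | yes refl = y ⁻¹ , here (cong₂ (λ a b → a ∷ b ∷ []) (*-zeroʳ (y ⁻¹))
                                    (*-inverseˡ {y} λ { refl → c≢𝟎 refl }))

commonTrue : List Bool → List Bool → Bool
commonTrue (a ∷ as) (b ∷ bs) = a ∧ b ∨ commonTrue as bs
commonTrue _        _        = false

-- Lets a coincidence be read off from two precomputed table entries.
does-any?-× : ∀ {A : Set} {P Q : A → Set} (P? : ∀ x → Dec (P x)) (Q? : ∀ x → Dec (Q x)) xs →
              does (Any.any? (λ x → P? x ×-dec Q? x) xs) ≡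
              commonTrue (List.map (does ∘ P?) xs) (List.map (does ∘ Q?) xs)
does-any?-× P? Q? []       = refl
does-any?-× P? Q? (x ∷ xs) = cong (does (P? x) ∧ does (Q? x) ∨_) (does-any?-× P? Q? xs)

-- A depth-first search for the images of some lines of a system of n lines: a branch
-- fixes the next line and the incidence conditions tested on its image. A condition
-- (k , i , j , i′ , j′) refers to lines chosen so far, the latest being number 0.
data Plan (n m : ℕ) : ℕ → Set where
  leaf   : Plan n m m
  branch : Fin n → List (Fin (suc d) × Fin (suc d) × Fin (suc d) × Fin (suc d) × Fin (suc d)) →
           Plan n m (suc d) → Plan n m d

chosen : Plan n m d → Vec (Fin n) d → Vec (Fin n) m
chosen leaf           bs = bs
chosen (branch b _ p) bs = chosen p (b ∷ bs)

module Lines {n} (ℓ : Vec (Echelon 5 2) n) where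

  line : Fin n → Echelon 5 2
  line = Vec.lookup ℓ

  pt : Fin n → Vector 2 → Vector 5
  pt i c = linComb c (rows (line i))

  pt∈ : ∀ i c → pt i c ∈ᴱ line i
  pt∈ i c = linComb∈ ⟦ line i ⟧ c (rows∈ (line i))

  pt-· : ∀ i s c → pt i (s · c) ≡ s · pt i c
  pt-· i s c = linComb-· s c (rows (line i))

  -- v lies in the span of the lines i and j, as subtraction is _⊕_.
  Meets : Fin n → Fin n → Vector 5 → Set
  Meets i j v = ∃ λ a → v ⊕ pt i a ∈ᴱ line j

  meets? : ∀ i j v → Dec (Meets i j v)
  meets? i j v = anyVector? 2 λ a → v ⊕ pt i a ∈ᴱ? line j

  meets-· : ∀ i j s v → Meets i j v → Meets i j (s · v)
  meets-· i j s v (a , p) = s · a ,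
    subst (_∈ᴱ line j) (trans (·-distribˡ s v (pt i a)) (cong (s · v ⊕_) (sym (pt-· i s a))))
          (∈ᴱ-· (line j) s _ p)

  Coincide : (k i j i′ j′ : Fin n) → Set
  Coincide k i j i′ j′ = Any (λ c → Meets i j (pt k c) × Meets i′ j′ (pt k c)) slopes

  coincide? : ∀ k i j i′ j′ → Dec (Coincide k i j i′ j′)
  coincide? k i j i′ j′ = Any.any? (λ c → meets? i j (pt k c) ×-dec meets? i′ j′ (pt k c)) slopes

  -- The form of `Coincide` without chosen representatives, which is the one that collineations
  -- visibly respect; `Coincide` itself is the one that can be tabulated.
  CommonPoint : (k i j i′ j′ : Fin n) → Set
  CommonPoint k i j i′ j′ = ∃ λ v → v ≢ 𝟎 × v ∈ᴱ line k × Meets i j v × Meets i′ j′ v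

  coincide⇒common : ∀ k i j i′ j′ → Coincide k i j i′ j′ → CommonPoint k i j i′ j′
  coincide⇒common k i j i′ j′ co =
    let c≢𝟎 , p , r = All.lookupAny slopes-nonzero co in
    pt k (Any.lookup co) , (λ eq → c≢𝟎 (rows-independent (line k) (Any.lookup co) eq))
    , pt∈ k (Any.lookup co) , p , r

  common⇒coincide : ∀ k i j i′ j′ → CommonPoint k i j i′ j′ → Coincide k i j i′ j′
  common⇒coincide k i j i′ j′ (v , v≢𝟎 , v∈ , p , r) with rows-span (line k) v v∈
  ... | c , refl = let s , sc∈ = slope c (λ { refl → v≢𝟎 (linComb-𝟎 (rows (line k))) }) in
    Any.map (λ { refl → subst (Meets i j) (sym (pt-· k s c)) (meets-· i j s _ p)
                      , subst (Meets i′ j′) (sym (pt-· k s c)) (meets-· i′ j′ s _ r) }) sc∈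

  record Permutes (f : SemilinearAut 5) (π : Fin n → Fin n) : Set where
    field
      maps     : ∀ i {v} → v ∈ᴱ line i → to f v ∈ᴱ line (π i)
      reflects : ∀ i {v} → to f v ∈ᴱ line (π i) → v ∈ᴱ line i

  module _ {f : SemilinearAut 5} {π : Fin n → Fin n} (perm : Permutes f π) where
    open Permutes perm

    meets-maps : ∀ i j v → Meets i j v → Meets (π i) (π j) (to f v)
    meets-maps i j v (a , p) with b , eq ← rows-span (line (π i)) _ (maps i (pt∈ i a)) =
      b , subst (_∈ᴱ line (π j)) (trans (to-⊕ f v (pt i a)) (cong (to f v ⊕_) eq)) (maps j p)

    meets-reflects : ∀ i j v → Meets (π i) (π j) (to f v) → Meets i j v
    meets-reflects i j v (b , p)
      with a , eq ← rows-span (line i) (from f (pt (π i) b))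
             (reflects i (subst (_∈ᴱ line (π i)) (sym (to∘from f _)) (pt∈ (π i) b))) =
      a , reflects j (subst (_∈ᴱ line (π j)) (begin
        to f v ⊕ pt (π i) b                     ≡⟨ cong (to f v ⊕_) (to∘from f _) ⟨
        to f v ⊕ to f (from f (pt (π i) b))     ≡⟨ to-⊕ f v _ ⟨
        to f (v ⊕ from f (pt (π i) b))          ≡⟨ cong (λ w → to f (v ⊕ w)) eq ⟩
        to f (v ⊕ pt i a)                       ∎) p)

    -- A common point is carried forward by `f` and back by its inverse. As an equivalence this
    -- makes the absence of a coincidence usable in the search too.
    coincide-⇔ : ∀ k i j i′ j′ → Coincide k i j i′ j′ ⇔ Coincide (π k) (π i) (π j) (π i′) (π j′)
    coincide-⇔ k i j i′ j′ = mk⇔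
      (λ co → let v , v≢𝟎 , v∈ , p , r = coincide⇒common k i j i′ j′ co in
        common⇒coincide _ _ _ _ _
          ( to f v , (λ eq → v≢𝟎 (to-injective f (trans eq (sym (to-𝟎 f))))) , maps k v∈
          , meets-maps i j v p , meets-maps i′ j′ v r ))
      (λ co → let w , w≢𝟎 , w∈ , p , r = coincide⇒common (π k) (π i) (π j) (π i′) (π j′) co
                  v = from f w
                  w≡ = sym (to∘from f w) in
        common⇒coincide _ _ _ _ _
          ( v , (λ eq → w≢𝟎 (trans w≡ (trans (cong (to f) eq) (to-𝟎 f))))
          , reflects k (subst (_∈ᴱ line (π k)) w≡ w∈)
          , meets-reflects i j v (subst (Meets (π i) (π j)) w≡ p)
          , meets-reflects i′ j′ v (subst (Meets (π i′) (π j′)) w≡ r) ))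

  -- Entry (i , j , k) records which points of line k lie in the span of i and j.
  Table : Set
  Table = Vec (Vec (Vec (List Bool) n) n) n

  table : Table
  table = Vec.tabulate λ i → Vec.tabulate λ j → Vec.tabulate λ k →
          List.map (λ c → does (meets? i j (pt k c))) slopes

  entry : Table → Fin n → Fin n → Fin n → List Bool
  entry t i j k = Vec.lookup (Vec.lookup (Vec.lookup t i) j) k

  entry-table : ∀ i j k → entry table i j k ≡ List.map (λ c → does (meets? i j (pt k c))) slopes
  entry-table i j k = begin
    entry table i j k
      ≡⟨ cong (λ t → Vec.lookup (Vec.lookup t j) k) (Vecₚ.lookup∘tabulate _ i) ⟩
    Vec.lookup (Vec.lookup (Vec.tabulate _) j) k
      ≡⟨ cong (λ t → Vec.lookup t k) (Vecₚ.lookup∘tabulate _ j) ⟩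
    Vec.lookup (Vec.tabulate _) k
      ≡⟨ Vecₚ.lookup∘tabulate _ k ⟩
    List.map (λ c → does (meets? i j (pt k c))) slopes ∎

  Condition : ℕ → Set
  Condition d = Fin d × Fin d × Fin d × Fin d × Fin d

  test : Table → Condition d → Vec (Fin n) d → Bool
  test t (k , i , j , i′ , j′) xs = commonTrue (entry t (x i) (x j) (x k)) (entry t (x i′) (x j′) (x k))
    where x = Vec.lookup xs

  test-table : ∀ (c@(k , i , j , i′ , j′) : Condition d) xs → let x = Vec.lookup xs in
               test table c xs ≡ does (coincide? (x k) (x i) (x j) (x i′) (x j′))
  test-table (k , i , j , i′ , j′) xs =
    trans (cong₂ commonTrue (entry-table (x i) (x j) (x k)) (entry-table (x i′) (x j′) (x k)))
          (sym (does-any?-× (λ c → meets? (x i) (x j) (pt (x k) c))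
                            (λ c → meets? (x i′) (x j′) (pt (x k) c)) slopes))
    where x = Vec.lookup xs

  module _ {f : SemilinearAut 5} {π : Fin n → Fin n} (perm : Permutes f π) where

    does-coincide : ∀ {k k₁ i i₁ j j₁ i′ i′₁ j′ j′₁} →
      k₁ ≡ π k → i₁ ≡ π i → j₁ ≡ π j → i′₁ ≡ π i′ → j′₁ ≡ π j′ →
      does (coincide? k i j i′ j′) ≡ does (coincide? k₁ i₁ j₁ i′₁ j′₁)
    does-coincide {k} {i = i} {j = j} {i′ = i′} {j′ = j′} refl refl refl refl refl =
      does-⇔ (coincide-⇔ perm k i j i′ j′) (coincide? _ _ _ _ _) (coincide? _ _ _ _ _)

    test-invariant : ∀ (c : Condition d) xs → test table c xs ≡ test table c (Vec.map π xs)
    test-invariant c@(k , i , j , i′ , j′) xs = begin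
      test table c xs                 ≡⟨ test-table c xs ⟩
      does (coincide? _ _ _ _ _)      ≡⟨ does-coincide (πx k) (πx i) (πx j) (πx i′) (πx j′) ⟩
      does (coincide? _ _ _ _ _)      ≡⟨ test-table c (Vec.map π xs) ⟨
      test table c (Vec.map π xs)     ∎
      where
      πx : ∀ p → Vec.lookup (Vec.map π xs) p ≡ π (Vec.lookup xs p)
      πx p = Vecₚ.lookup-map p π xs

  tests : Table → List (Condition d) → Vec (Fin n) d → List Bool
  tests t cs xs = List.map (λ c → test t c xs) cs

  -- Here `bs` are the base lines chosen so far and `xs` their tentative images. A branch survives
  -- only if the images give exactly the test results of the base lines, and `Q` must hold at each
  -- surviving leaf.
  Exhausts : Table → (Vec (Fin n) m → Set) → Plan n m d → (bs xs : Vec (Fin n) d) → Set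
  Exhausts t Q leaf            bs xs = Q xs
  Exhausts t Q (branch b cs p) bs xs = ∀ x →
    tests t cs (x ∷ xs) ≡ tests t cs (b ∷ bs) → Exhausts t Q p (b ∷ bs) (x ∷ xs)

  exhausts? : ∀ t {Q : Vec (Fin n) m → Set} → (∀ xs → Dec (Q xs)) →
              (p : Plan n m d) (bs xs : Vec (Fin n) d) → Dec (Exhausts t Q p bs xs)
  exhausts? t Q? leaf            bs xs = Q? xs
  exhausts? t {Q} Q? (branch b cs p) bs xs = against (tests t cs (b ∷ bs))
    where
    -- A function of the expected results, so that they are evaluated only once.
    against : ∀ expected → Dec (∀ x → tests t cs (x ∷ xs) ≡ expected → Exhausts t Q p (b ∷ bs) (x ∷ xs))
    against expected = Finₚ.all? λ x →
      Listₚ.≡-dec Boolₚ._≟_ (tests t cs (x ∷ xs)) expected →-dec exhausts? t Q? p (b ∷ bs) (x ∷ xs)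

  -- The actual images `π b` pass every test, so they label a surviving path of the search tree.
  exhausts-sound : ∀ {f π} → Permutes f π → ∀ {Q : Vec (Fin n) m → Set} (p : Plan n m d) bs →
                   Exhausts table Q p bs (Vec.map π bs) → Q (Vec.map π (chosen p bs))
  exhausts-sound         perm leaf            bs q  = q
  exhausts-sound {π = π} perm (branch b cs p) bs ex = exhausts-sound perm p (b ∷ bs)
    (ex (π b) (sym (Listₚ.map-cong (λ c → test-invariant perm c (b ∷ bs)) cs)))

  Images : ℕ → Set
  Images m = Vec (Vec (Vector 5) 2) m

  images : SemilinearAut 5 → Vec (Fin n) m → Images m
  images h = Vec.map (λ b → Vec.map (to h) (rows (line b)))

  Fits : Vec (Fin n) m → Images m → Set
  Fits xs = Pointwise (λ x → VecAll.All (_∈ᴱ line x)) xs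

  fits? : (xs : Vec (Fin n) m) (ims : Images m) → Dec (Fits xs ims)
  fits? = Pointwise.decidable λ x → VecAll.all? (_∈ᴱ? line x)

  Fitting : List (Images m) → Vec (Fin n) m → Set
  Fitting imss xs = Any (Fits xs) imss

  Complete : Table → List (Images m) → Plan n m 0 → Set
  Complete t imss p = Exhausts t (Fitting imss) p [] []

  complete? : ∀ t (imss : List (Images m)) p → Dec (Complete t imss p)
  complete? t imss p = exhausts? t (λ xs → Any.any? (fits? xs) imss) p [] []

  -- The intersection of the line `k` with the span of `i` and `j` consists of the multiples of `w`.
  -- The scalar `0#` is listed because `c` may be zero.
  Anchored : Fin n × Fin n × Fin n → Vector 5 → Set
  Anchored (k , i , j) w = w ∈ᴱ line k × Meets i j w ×
    (∀ c → Meets i j (pt k c) → Any (λ s → pt k c ≡ s · w) (0# ∷ 1# ∷ ω ∷ ω² ∷ []))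

  anchored? : ∀ a w → Dec (Anchored a w)
  anchored? (k , i , j) w = w ∈ᴱ? line k ×-dec meets? i j w ×-dec
    allVectors? 2 λ c → meets? i j (pt k c) →-dec Any.any? (λ s → pt k c ≟ᵛ s · w) _

  module _ (g : SemilinearAut 5) where

    Stabilises : Fin n → Set
    Stabilises i = ∀ {v} → v ∈ᴱ line i → to g v ∈ᴱ line i

    -- The image of `w` lies again on the line `k` and in the span of `i` and `j`, hence is a
    -- multiple of `w`.
    anchored⇒fixes : ∀ {k i j w} → Anchored (k , i , j) w →
                     Stabilises k → Stabilises i → Stabilises j → Fixes g w
    anchored⇒fixes {k} {i} {j} {w} (w∈k , (a , w+a∈j) , unique) stabₖ stabᵢ stabⱼ
      with c , gw≡ ← rows-span (line k) (to g w) (stabₖ w∈k)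
      with b , ga≡ ← rows-span (line i) (to g (pt i a)) (stabᵢ (pt∈ i a)) =
      let s , eq = Any.satisfied (unique c (b , subst (_∈ᴱ line j)
                     (trans (to-⊕ g w (pt i a)) (cong₂ _⊕_ gw≡ ga≡)) (stabⱼ w+a∈j))) in
      s , trans gw≡ eq

  module Classification (B : SemilinearAut 5) (K : List (SemilinearAut 5)) (plan : Plan n m 0)
                        (anchors : Vec (Fin m × Fin m × Fin m) 6) where
    open Frame B

    base : Vec (Fin n) m
    base = chosen plan []

    Anchors : Set
    Anchors = Pointwise (λ (k , i , j) → Anchored (Vec.lookup base k , Vec.lookup base i , Vec.lookup base j))
                        anchors frame

    anchors? : Dec Anchors
    anchors? = Pointwise.decidable (λ (k , i , j) → anchored? _) anchors frame

    candidates : List (SemilinearAut 5)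
    candidates = twists conjugation K

    module _ (anchored : Anchors) (complete : Complete table (List.map (λ h → images h base) K) plan) where

      -- Both `f` and `h` send each base line `b` to the line `π b`, so `g` stabilises all base
      -- lines and fixes the frame points anchored to them.
      agrees : ∀ {f π} → Permutes f π → ∀ {h} → Fits (Vec.map π base) (images h base) →
               f ∼ h ⊎ f ∼ h ∘ₛ conjugation
      agrees {f} {π} perm {h} fits = cases (fixing-frame g (fixesFrame anchored))
        where
        open Permutes perm
        g : SemilinearAut 5
        g = invₛ f ∘ₛ h

        stabilises : ∀ p → Stabilises g (Vec.lookup base p)
        stabilises p {v} v∈ with cs , refl ← rows-span (line (Vec.lookup base p)) v v∈ =
          reflects b (subst (_∈ᴱ line (π b)) (sym (trans (to∘from f _) (to-linComb h cs (rows (line b)))))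
            (linComb∈ ⟦ line (π b) ⟧ (Vec.map (σ h) cs)
              (subst₂ (λ x → VecAll.All (_∈ᴱ line x)) (Vecₚ.lookup-map p π base)
                      (Vecₚ.lookup-map p (λ b → Vec.map (to h) (rows (line b))) base)
                      (Pointwise.lookup fits p))))
          where b = Vec.lookup base p

        fixesFrame : ∀ {r} {as : Vec (Fin m × Fin m × Fin m) r} {ws : Vec (Vector 5) r} →
          Pointwise (λ (k , i , j) → Anchored (Vec.lookup base k , Vec.lookup base i , Vec.lookup base j)) as ws →
          VecAll.All (Fixes g) ws
        fixesFrame []                           = []
        fixesFrame {as = (k , i , j) ∷ _} (a ∷ as) =
          anchored⇒fixes g a (stabilises k) (stabilises i) (stabilises j) ∷ fixesFrame as

        cases : g ∼ idₛ ⊎ g ∼ conjugation → f ∼ h ⊎ f ∼ h ∘ₛ conjugation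
        cases (inj₁ g∼id) = inj₁ (∼-∘-involution f h idₛ (λ _ → refl) g∼id)
        cases (inj₂ g∼β)  = inj₂ (∼-∘-involution f h conjugation conjugation-involutive g∼β)

      classification : ∀ f π → Permutes f π → Any (f ∼_) candidates
      classification f π perm = any-twists f conjugation
        (Any.map (λ {h} → agrees perm {h}) (Anyₚ.map⁻ (exhausts-sound perm plan [] complete)))

-- Orbits

-- For a list (f₁ , n₁) , … , (fᵣ , nᵣ): all f₁^i₁ (… (fᵣ^iᵣ x)) with each iⱼ < nⱼ.
walk : ∀ {a} {A : Set a} → List ((A → A) × ℕ) → A → List A
walk []             x = x ∷ []
walk ((f , n) ∷ fs) x = List.concatMap (λ y → List.iterate f y n) (walk fs x)

words : List (SemilinearAut k × ℕ) → List (SemilinearAut k)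
words gs = walk (List.map (map₁ _∘ₛ_) gs) idₛ

orbit : List (SemilinearAut k × ℕ) → List (Vector k) → Multiset k
orbit gs vs = List.map ⟪_⟫ (walk (List.map (map₁ (List.map ∘ to)) gs) vs)

-- Verifying the counts

-- In dual terms: the annihilators of the members cover every point of the dual space exactly `r`
-- times.
HyperplaneCount : ℕ → Multiset k → Set
HyperplaneCount {k} r 𝓢 = (φ : Vector k) → φ ≢ 𝟎 →
  List.length (List.filter (λ S → annihilates? φ (Subspace.basis S)) 𝓢) ≡ r

hyperplaneCount? : ∀ r (𝓢 : Multiset k) → Dec (HyperplaneCount r 𝓢)
hyperplaneCount? r 𝓢 = allVectors? _ λ φ → ¬? (φ ≟ᵛ 𝟎) →-dec (_ ℕₚ.≟ r)

hyperplaneCount⇒#containedIn : ∀ {r} (𝓢 : Multiset k) → HyperplaneCount r 𝓢 →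
                               (H : Subspace k) → IsHyperplane H → #containedIn H 𝓢 ≡ r
hyperplaneCount⇒#containedIn 𝓢 count H isHyperplane =
  trans (#containedIn≡ H isHyperplane 𝓢) (count (normal H isHyperplane) (normal≢𝟎 H isHyperplane))

Covering : ℕ → ℕ → Multiset k → Set
Covering {k} h μ 𝓢 = (v : Vector k) → v ≢ 𝟎 →
  sum (List.map (λ S → q ^ (h ∸ dim S)) (List.filter (v ∈?_) 𝓢)) ≡ μ

covering? : ∀ h μ (𝓢 : Multiset k) → Dec (Covering h μ 𝓢)
covering? h μ 𝓢 = allVectors? _ λ v → ¬? (v ≟ᵛ 𝟎) →-dec (_ ℕₚ.≟ μ)

isMultispread? : ∀ l μ h (𝓢 : Multiset k) → Dec (IsMultispread l μ h k 𝓢)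
isMultispread? l μ h 𝓢 = map′
  (λ (dim≤h , covering , excess) → record { dim≤h = dim≤h ; covering = covering ; excess = excess })
  (λ 𝓢-is → let open IsMultispread 𝓢-is in dim≤h , covering , excess)
  (All.all? (λ S → dim S ℕₚ.≤? h) 𝓢 ×-dec covering? h μ 𝓢 ×-dec (_ ℕₚ.≟ l))

dims? : (𝓢 : Multiset k) → Dec (All (λ S → dim S ≡ 2 ⊎ dim S ≡ 3) 𝓢)
dims? = All.all? λ S → dim S ℕₚ.≟ 2 ⊎-dec dim S ℕₚ.≟ 3

-- Automorphisms

_≈?_ : (S T : Subspace k) → Dec (S ≈ T)
S ≈? T = (S ⊆? T) ×-dec (T ⊆? S)

module _ {k : ℕ} where
  open Permutation (subspaceSetoid k) using (↭-refl; ↭-trans; ↭-prep; ↭-swap; prep)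

  -- Removing the first member equal to `S` is enough for matching multisets, with no backtracking,
  -- since `≈` is an equivalence.
  extract : (S : Subspace k) (𝓣 : Multiset k) → Maybe (∃ λ 𝓤 → S ∷ 𝓤 ↭ 𝓣)
  extract S []      = nothing
  extract S (T ∷ 𝓣) with S ≈? T
  ... | yes S≈T = just (𝓣 , prep S≈T ↭-refl)
  ... | no  _   = Maybe.map (λ (𝓤 , p) → T ∷ 𝓤 , ↭-trans (↭-swap S T ↭-refl) (↭-prep T p)) (extract S 𝓣)

  permutation? : (𝓢 𝓣 : Multiset k) → Maybe (𝓢 ↭ 𝓣)
  permutation? []      []      = just ↭-refl
  permutation? []      (_ ∷ _) = nothing
  permutation? (S ∷ 𝓢) 𝓣 = do
    𝓤 , S∷𝓤↭𝓣 ← extract S 𝓣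
    𝓢↭𝓤 ← permutation? 𝓢 𝓤
    just (↭-trans (↭-prep S 𝓢↭𝓤) S∷𝓤↭𝓣)

  open Membership (subspaceSetoid k) public using () renaming (_∈_ to _∈ₛ_)
  open Membership (subspaceSetoid k) using (find)

  preserves⇒∈ : (f : SemilinearAut k) {𝓢 : Multiset k} → f Preserves 𝓢 →
                ∀ {S} → S ∈ₛ 𝓢 → image f S ∈ₛ 𝓢
  preserves⇒∈ f p {S} S∈𝓢 = Permutationₚ.∈-resp-↭ (subspaceSetoid k) {image f S} p
    (Anyₚ.map⁺ (Any.map (λ {T} → image-cong f {S} {T}) S∈𝓢))

  -- The image of some member is contained in no member. This is stronger than being equal to none,
  -- and it is decided on the images of basis vectors alone.
  Moves : SemilinearAut k → Multiset k → Set₁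
  Moves f 𝓢 = Any (λ S → All (λ T → ¬ VecAll.All (_∈ T) (Vec.map (to f) (Subspace.basis S))) 𝓢) 𝓢

  moves? : ∀ f (𝓢 : Multiset k) → Dec (Moves f 𝓢)
  moves? f 𝓢 = Any.any? (λ S → avoids? (Vec.map (to f) (Subspace.basis S))) 𝓢
    where
    avoids? : (vs : Vec (Vector k) n) → Dec (All (λ T → ¬ VecAll.All (_∈ T) vs) 𝓢)
    avoids? vs = All.all? (λ T → ¬? (VecAll.all? (_∈? T) vs)) 𝓢

  preserves⇒¬moves : (f h : SemilinearAut k) {𝓢 : Multiset k} → f Preserves 𝓢 → f ∼ h → ¬ Moves h 𝓢
  preserves⇒¬moves f h {𝓢} p (c , c≢0 , f≡ch) moves with find moves
  ... | S , S∈𝓢 , none with All.lookupAny none (preserves⇒∈ f p {S} S∈𝓢)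
  ... | ¬hS⊆T₀ , fS≈T₀ = ¬hS⊆T₀ (VecAllₚ.map⁺ (VecAll.map (λ {v} v∈S →
    subst (_∈ T₀) (sym (⁻¹-·-cancel c≢0 (f≡ch v)))
          (Subspace.·-closed T₀ (c ⁻¹) (proj₁ fS≈T₀ (v , v∈S , refl))))
    (Subspace.basis⊆ S)))
    where T₀ = Any.lookup (preserves⇒∈ f p {S} S∈𝓢)

-- The lines are characterised within 𝓢 as the members of dimension 2 that lie in no
-- member of dimension 3, so automorphisms of 𝓢 permute them.
module Distinguished {n} (ℓ : Vec (Echelon 5 2) n) (𝓢 : Multiset 5) where
  open Lines ℓ

  IsDistinguished : Set₁
  IsDistinguished =
      (∀ i → ⟦ line i ⟧ ∈ₛ 𝓢)
    × (∀ i → All (λ T → dim T ≡ 3 → ¬ ⟦ line i ⟧ ⊆ T) 𝓢)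
    × All (λ T → (∃ λ i → T ≈ ⟦ line i ⟧) ⊎ Any (λ D → dim D ≡ 3 × T ⊆ D) 𝓢) 𝓢

  isDistinguished? : Dec IsDistinguished
  isDistinguished? =
      Finₚ.all? (λ i → Any.any? (⟦ line i ⟧ ≈?_) 𝓢)
    ×-dec Finₚ.all? (λ i → All.all? (λ T → dim T ℕₚ.≟ 3 →-dec ¬? (⟦ line i ⟧ ⊆? T)) 𝓢)
    ×-dec All.all? (λ T → Finₚ.any? (λ i → T ≈? ⟦ line i ⟧)
                          ⊎-dec Any.any? (λ D → dim D ℕₚ.≟ 3 ×-dec T ⊆? D) 𝓢) 𝓢

  -- The image of a line is a member `T`. If `T` lay in a three-dimensional member `D`, the preimage
  -- of `D` would be a three-dimensional member containing the line, which `isolated` forbids; so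
  -- `T` is one of the lines.
  permutesLines : IsDistinguished → ∀ f → f Preserves 𝓢 → ∃ (Permutes f)
  permutesLines (lines∈ , isolated , rest) f f-preserves = proj₁ ∘ image-line , record
    { maps     = λ i {v} v∈ → proj₁ (proj₂ (image-line i)) (v , v∈ , refl)
    ; reflects = λ i fv∈ → case proj₂ (proj₂ (image-line i)) fv∈ of
        λ { (u , u∈ , fu≡fv) → subst (_∈ᴱ line i) (to-injective f fu≡fv) u∈ } }
    where
    f⁻-preserves : invₛ f Preserves 𝓢
    f⁻-preserves = inv-preserves f 𝓢 f-preserves

    not-isolated : ∀ i {T} → image f ⟦ line i ⟧ ≈ T → ¬ Any (λ D → dim D ≡ 3 × T ⊆ D) 𝓢
    not-isolated i {T} fℓ≈T any with Membership.find (subspaceSetoid 5) any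
    ... | D , D∈𝓢 , dimD≡3 , T⊆D
      with D′∈𝓢 ← preserves⇒∈ (invₛ f) f⁻-preserves {D} D∈𝓢
      with ¬ℓ⊆D′ , f⁻D≈D′ ← All.lookupAny (isolated i) D′∈𝓢 =
      ¬ℓ⊆D′ (trans (sym (dim-cong {S = image (invₛ f) D} {Any.lookup D′∈𝓢} f⁻D≈D′)) dimD≡3)
            (λ {v} v∈ → proj₁ f⁻D≈D′ (to f v , T⊆D (proj₁ fℓ≈T (v , v∈ , refl)) , from∘to f v))

    image-line : ∀ i → ∃ λ j → image f ⟦ line i ⟧ ≈ ⟦ line j ⟧
    image-line i with fℓ∈𝓢 ← preserves⇒∈ f f-preserves {⟦ line i ⟧} (lines∈ i)
      with All.lookupAny rest fℓ∈𝓢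
    ... | inj₁ (j , T≈ℓ) , fℓ≈T = j , proj₁ T≈ℓ ∘ proj₁ fℓ≈T , proj₂ fℓ≈T ∘ proj₂ T≈ℓ
    ... | inj₂ any       , fℓ≈T = contradiction any (not-isolated i {Any.lookup fℓ∈𝓢} fℓ≈T)

-- The order of the automorphism group

module _ {a r} (G : Group a r) where
  open Group G using () renaming (_≈_ to _≈ᴳ_)
  private
    module G = Group G

  lookup-injective : ∀ {xs} → AllPairs (λ x y → ¬ x ≈ᴳ y) xs →
                     ∀ {i j} → List.lookup xs i ≈ᴳ List.lookup xs j → i ≡ j
  lookup-injective (_ ∷ _)  {zero}  {zero}  _  = refl
  lookup-injective (p ∷ _)  {zero}  {suc j} eq = contradiction eq (All.lookup p (∈-lookup j))
  lookup-injective (p ∷ _)  {suc i} {zero}  eq = contradiction (G.sym eq) (All.lookup p (∈-lookup i))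
  lookup-injective (_ ∷ ps) {suc i} {suc j} eq = cong suc (lookup-injective ps eq)

  hasOrder : ∀ xs → AllPairs (λ x y → ¬ x ≈ᴳ y) xs → (∀ y → Any (y ≈ᴳ_) xs) → HasOrder G (List.length xs)
  hasOrder xs distinct complete = record
    { to        = List.lookup xs
    ; cong      = λ { refl → G.refl }
    ; bijective = lookup-injective distinct
                , λ y → Any.index (complete y) , λ { refl → G.sym (Anyₚ.lookup-index (complete y)) } }

Snapshot : Set
Snapshot = 𝔽₄ × Vec (Vector 5) 5

snapshot : SemilinearAut 5 → Snapshot
snapshot f = σ f ω , unitImages f

Matches : (s t : Snapshot) → Set
Matches (x , us) (y , vs) = x ≡ y × Proportional us vs

matches? : ∀ s t → Dec (Matches s t)
matches? (x , us) (y , vs) = x ≟ y ×-dec proportional? us vs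

matches⇒∼ : ∀ f g → Matches (snapshot f) (snapshot g) → f ∼ g
matches⇒∼ f g (eq , prop) = proportional⇒∼ f g eq prop

-- Only unit images are compared: collineations equal up to scalars have proportional unit images,
-- so non-proportional ones suffice for distinctness.
Distinct : List Snapshot → Set
Distinct = AllPairs (λ s t → ¬ Proportional (proj₂ s) (proj₂ t))

distinct? : ∀ ss → Dec (Distinct ss)
distinct? = AllPairs.allPairs? (λ s t → ¬? (proportional? (proj₂ s) (proj₂ t)))

Accounted : List Snapshot → Multiset 5 → SemilinearAut 5 → Set₁
Accounted ss 𝓢 h = Any (Matches (snapshot h)) ss ⊎ Moves h 𝓢

accounted? : ∀ ss 𝓢 h → Dec (Accounted ss 𝓢 h)
accounted? ss 𝓢 h = any-match? (snapshot h) ⊎-dec moves? h 𝓢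
  where
  any-match? : ∀ s → Dec (Any (Matches s) ss)
  any-match? s = Any.any? (matches? s) ss

module Order (𝓢 : Multiset 5) (gens : List (Automorphism 𝓢 × ℕ)) where
  open Automorphism renaming (map to collineation)

  elements : List (Automorphism 𝓢)
  elements = walk (List.map (map₁ (Group._∙_ (Aut 𝓢))) gens) (Group.ε (Aut 𝓢))

  snapshots : List Snapshot
  snapshots = List.map (snapshot ∘ collineation) elements

  Accounts : List (SemilinearAut 5) → Set₁
  Accounts hs = Distinct snapshots × All (Accounted snapshots 𝓢) hs

  accounts? : ∀ hs → Dec (Accounts hs)
  accounts? hs = check snapshots 𝓢
    where
    -- Abstracted over the snapshots and the multiset, so that their evaluation is shared by all
    -- candidates.
    check : ∀ ss 𝓣 → Dec (Distinct ss × All (Accounted ss 𝓣) hs)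
    check ss 𝓣 = distinct? ss ×-dec All.all? (accounted? ss 𝓣) hs

  -- An automorphism equals some candidate up to scalars. A candidate that moves a member out of 𝓢
  -- is impossible here, so it matches a listed element, and the listed elements are pairwise
  -- distinct.
  order : ∀ hs → Accounts hs → (∀ f → f Preserves 𝓢 → Any (f ∼_) hs) →
          HasOrder (Aut 𝓢) (List.length elements)
  order hs (distinct , accounted) covers = hasOrder (Aut 𝓢) elements
    (AllPairs.map (λ {f} {g} ¬prop f∼g → ¬prop (∼⇒proportional (collineation f) (collineation g) f∼g))
                  (AllPairsₚ.map⁻ distinct))
    represent
    where
    represent : ∀ f → Any (λ g → collineation f ∼ collineation g) elements
    represent f = cases (All.lookupAny accounted covered)
      where
      covered = covers (collineation f) (preserves f)
      h = Any.lookup covered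

      cases : Accounted snapshots 𝓢 h × collineation f ∼ h → Any (λ g → collineation f ∼ collineation g) elements
      cases (inj₁ match , f∼h) = Any.map
        (λ {g} m → ∼-trans {f = collineation f} {h} {collineation g} f∼h (matches⇒∼ h (collineation g) m))
        (Anyₚ.map⁻ match)
      cases (inj₂ moves , f∼h) =
        contradiction moves (preserves⇒¬moves (collineation f) h (preserves f) f∼h)

-- The examples

row : (a b c d e : 𝔽₄) → Vector 5
row a b c d e = a ∷ b ∷ c ∷ d ∷ e ∷ []

-- The coordinates (x₀ , x₁ , y , z₀ , z₁) stand for x₀ + x₁θ , yθ mod 𝔽₄ and z₀ + z₁θ in
-- 𝔽₁₆ ⊕ 𝔽₁₆/𝔽₄ ⊕ 𝔽₁₆, where θ² = θ + ω. The following five maps permute the 17 lines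
-- ℓₜ = { (x , xt , xt²) }, t ∈ 𝔽₁₆ ∪ {∞}, sending t to t + 1, t + ω, ωt, 1/t and t².
shift₁ : SemilinearAut 5
shift₁ = matrixAut identity
  (row 1# 0# 0# 1# 0# ∷ row 0# 1# 1# 0# 1# ∷ row 0# 0# 1# 0# 0#
  ∷ row 0# 0# 0# 1# 0# ∷ row 0# 0# 0# 0# 1# ∷ [])
  (row 1# 0# 0# 1# 0# ∷ row 0# 1# 1# 0# 1# ∷ row 0# 0# 1# 0# 0#
  ∷ row 0# 0# 0# 1# 0# ∷ row 0# 0# 0# 0# 1# ∷ [])
  refl

shiftω : SemilinearAut 5
shiftω = matrixAut identity
  (row 1# 0# 0# ω² 0# ∷ row 0# 1# ω 0# ω² ∷ row 0# 0# 1# 0# 0#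
  ∷ row 0# 0# 0# 1# 0# ∷ row 0# 0# 0# 0# 1# ∷ [])
  (row 1# 0# 0# ω² 0# ∷ row 0# 1# ω 0# ω² ∷ row 0# 0# 1# 0# 0#
  ∷ row 0# 0# 0# 1# 0# ∷ row 0# 0# 0# 0# 1# ∷ [])
  refl

scale : SemilinearAut 5
scale = matrixAut identity
  (row 1# 0# 0# 0# 0# ∷ row 0# 1# 0# 0# 0# ∷ row 0# 0# ω 0# 0#
  ∷ row 0# 0# 0# ω² 0# ∷ row 0# 0# 0# 0# ω² ∷ [])
  (row 1# 0# 0# 0# 0# ∷ row 0# 1# 0# 0# 0# ∷ row 0# 0# ω² 0# 0#
  ∷ row 0# 0# 0# ω 0# ∷ row 0# 0# 0# 0# ω ∷ [])
  refl

reciprocal : SemilinearAut 5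
reciprocal = matrixAut identity
  (row 0# 0# 0# 1# 0# ∷ row 0# 0# 0# 0# 1# ∷ row 0# 0# 1# 0# 0#
  ∷ row 1# 0# 0# 0# 0# ∷ row 0# 1# 0# 0# 0# ∷ [])
  (row 0# 0# 0# 1# 0# ∷ row 0# 0# 0# 0# 1# ∷ row 0# 0# 1# 0# 0#
  ∷ row 1# 0# 0# 0# 0# ∷ row 0# 1# 0# 0# 0# ∷ [])
  refl

conjugate : SemilinearAut 5
conjugate = matrixAut frobenius
  (row 1# 0# 0# 0# 0# ∷ row ω 1# 0# 0# 0# ∷ row 0# 0# 1# 0# 0#
  ∷ row 0# 0# 0# 1# 0# ∷ row 0# 0# 0# ω 1# ∷ [])
  (row 1# 0# 0# 0# 0# ∷ row ω² 1# 0# 0# 0# ∷ row 0# 0# 1# 0# 0#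
  ∷ row 0# 0# 0# 1# 0# ∷ row 0# 0# 0# ω² 1# ∷ [])
  refl

rotation conjugate² twist : SemilinearAut 5
rotation   = reciprocal ∘ₛ shiftω
conjugate² = conjugate ∘ₛ conjugate
twist      = shift₁ ∘ₛ scale ∘ₛ scale ∘ₛ conjugate

-- The lines ℓₜ with t ∈ 𝔽₁₆ ∖ 𝔽₄.
conicLines : Vec (Echelon 5 2) 12
conicLines =
    pivot (0# ∷ 1# ∷ 0# ∷ 1# ∷ []) (pivot (ω ∷ ω ∷ 1# ∷ []) (skip (skip (skip []))))
  ∷ pivot (0# ∷ 1# ∷ 1# ∷ 1# ∷ []) (pivot (ω² ∷ ω ∷ 0# ∷ []) (skip (skip (skip []))))
  ∷ pivot (0# ∷ 1# ∷ ω² ∷ 1# ∷ []) (pivot (0# ∷ ω ∷ ω ∷ []) (skip (skip (skip []))))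
  ∷ pivot (0# ∷ 1# ∷ ω ∷ 1# ∷ []) (pivot (1# ∷ ω ∷ ω² ∷ []) (skip (skip (skip []))))
  ∷ pivot (0# ∷ ω ∷ 0# ∷ ω² ∷ []) (pivot (ω² ∷ 1# ∷ ω² ∷ []) (skip (skip (skip []))))
  ∷ pivot (0# ∷ ω ∷ 1# ∷ ω² ∷ []) (pivot (ω ∷ 1# ∷ ω ∷ []) (skip (skip (skip []))))
  ∷ pivot (0# ∷ ω ∷ ω² ∷ ω² ∷ []) (pivot (1# ∷ 1# ∷ 0# ∷ []) (skip (skip (skip []))))
  ∷ pivot (0# ∷ ω ∷ ω ∷ ω² ∷ []) (pivot (0# ∷ 1# ∷ 1# ∷ []) (skip (skip (skip []))))
  ∷ pivot (0# ∷ ω² ∷ 0# ∷ ω ∷ []) (pivot (1# ∷ ω² ∷ ω ∷ []) (skip (skip (skip []))))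
  ∷ pivot (0# ∷ ω² ∷ 1# ∷ ω ∷ []) (pivot (0# ∷ ω² ∷ ω² ∷ []) (skip (skip (skip []))))
  ∷ pivot (0# ∷ ω² ∷ ω² ∷ ω ∷ []) (pivot (ω² ∷ ω² ∷ 1# ∷ []) (skip (skip (skip []))))
  ∷ pivot (0# ∷ ω² ∷ ω ∷ ω ∷ []) (pivot (ω ∷ ω² ∷ 0# ∷ []) (skip (skip (skip []))))
  ∷ []

-- Each column of the frame, and the sum of the columns, is the point where one line of the
-- search below meets the span of two others. The anchors name these lines, starting with
-- those for the sum.
conicFrame : SemilinearAut 5
conicFrame = matrixAut identity
  (row 0# 1# 1# 1# 0# ∷ row 1# 0# 1# 1# 1# ∷ row 1# ω 1# ω² 0#
  ∷ row 1# 1# ω² ω 0# ∷ row 1# ω² 1# ω 0# ∷ [])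
  (row 0# 0# ω ω² 0# ∷ row 1# 0# 1# ω² ω ∷ row 1# 0# 1# 0# 1#
  ∷ row 1# 0# 0# ω² ω² ∷ row 0# 1# ω² 0# ω ∷ [])
  refl

-- Found by a greedy search for short condition lists and a small tree.
conicPlan : Plan 12 8 0
conicPlan =
  branch (# 0) []
  (branch (# 5) ((# 1 , # 0 , # 0 , # 1 , # 1) ∷ [])
  (branch (# 6) ((# 2 , # 0 , # 0 , # 2 , # 2) ∷ (# 1 , # 0 , # 0 , # 1 , # 1) ∷ [])
  (branch (# 10) ((# 3 , # 0 , # 1 , # 0 , # 2) ∷ (# 3 , # 0 , # 0 , # 3 , # 3) ∷ [])
  (branch (# 8) ((# 4 , # 0 , # 2 , # 0 , # 3) ∷ (# 3 , # 0 , # 1 , # 0 , # 4) ∷ [])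
  (branch (# 1) ((# 0 , # 2 , # 5 , # 3 , # 4) ∷ (# 0 , # 1 , # 5 , # 2 , # 3) ∷ [])
  (branch (# 2) ((# 5 , # 0 , # 1 , # 0 , # 3) ∷ (# 4 , # 0 , # 2 , # 1 , # 2) ∷ [])
  (branch (# 3) ((# 7 , # 0 , # 1 , # 0 , # 2) ∷ (# 6 , # 0 , # 3 , # 2 , # 3) ∷ [])
  leaf)))))))

conicAnchors : Vec (Fin 8 × Fin 8 × Fin 8) 6
conicAnchors =
    (# 4 , # 6 , # 7)
  ∷ (# 5 , # 2 , # 6)
  ∷ (# 2 , # 5 , # 6)
  ∷ (# 6 , # 2 , # 7)
  ∷ (# 7 , # 2 , # 6)
  ∷ (# 1 , # 6 , # 7)
  ∷ []

-- In 𝔽₆₄ ⊕ 𝔽₄² with the basis 1, X, X² of 𝔽₆₄ over 𝔽₄, X³ = X + 1: multiplication by X, and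
-- the 𝔽₄-linear extension of squaring on 𝔽₈ together with an element of order 3 on 𝔽₄².
singer : SemilinearAut 5
singer = matrixAut identity
  (row 0# 1# 0# 0# 0# ∷ row 0# 0# 1# 0# 0# ∷ row 1# 1# 0# 0# 0#
  ∷ row 0# 0# 0# 1# 0# ∷ row 0# 0# 0# 0# 1# ∷ [])
  (row 1# 0# 1# 0# 0# ∷ row 1# 0# 0# 0# 0# ∷ row 0# 1# 0# 0# 0#
  ∷ row 0# 0# 0# 1# 0# ∷ row 0# 0# 0# 0# 1# ∷ [])
  refl

squaring : SemilinearAut 5
squaring = matrixAut identity
  (row 1# 0# 0# 0# 0# ∷ row 0# 0# 1# 0# 0# ∷ row 0# 1# 1# 0# 0#
  ∷ row 0# 0# 0# 0# 1# ∷ row 0# 0# 0# 1# 1# ∷ [])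
  (row 1# 0# 0# 0# 0# ∷ row 0# 1# 1# 0# 0# ∷ row 0# 1# 0# 0# 0#
  ∷ row 0# 0# 0# 1# 1# ∷ row 0# 0# 0# 1# 0# ∷ [])
  refl

-- The successive images under `singer` of the line spanned by `X + e` and `X² + f`, where `e`, `f`
-- is the standard basis of 𝔽₄².
heptad : Vec (Echelon 5 2) 7
heptad =
    skip (pivot (0# ∷ 1# ∷ 0# ∷ []) (pivot (0# ∷ 1# ∷ []) (skip (skip []))))
  ∷ pivot (1# ∷ 0# ∷ 0# ∷ 1# ∷ []) (skip (pivot (1# ∷ 0# ∷ []) (skip (skip []))))
  ∷ pivot (0# ∷ 1# ∷ 1# ∷ 1# ∷ []) (pivot (1# ∷ 0# ∷ 1# ∷ []) (skip (skip (skip []))))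
  ∷ pivot (0# ∷ 0# ∷ 1# ∷ 1# ∷ []) (pivot (1# ∷ 1# ∷ 0# ∷ []) (skip (skip (skip []))))
  ∷ pivot (0# ∷ 1# ∷ 0# ∷ 1# ∷ []) (pivot (0# ∷ 1# ∷ 1# ∷ []) (skip (skip (skip []))))
  ∷ pivot (0# ∷ 0# ∷ 0# ∷ 1# ∷ []) (skip (pivot (1# ∷ 1# ∷ []) (skip (skip []))))
  ∷ pivot (0# ∷ 0# ∷ 1# ∷ 0# ∷ []) (pivot (0# ∷ 0# ∷ 1# ∷ []) (skip (skip (skip []))))
  ∷ []

heptadFrame : SemilinearAut 5
heptadFrame = matrixAut identity
  (row 1# 1# 0# 1# 0# ∷ row 0# 1# 1# 1# 0# ∷ row 1# 0# 0# 1# 0#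
  ∷ row 0# 1# 0# 1# 0# ∷ row 0# 0# 1# 0# 1# ∷ [])
  (row 1# 0# 0# 1# 0# ∷ row 1# 0# 1# 0# 0# ∷ row 0# 1# 0# 1# 0#
  ∷ row 1# 0# 1# 1# 0# ∷ row 0# 1# 0# 1# 1# ∷ [])
  refl

heptadPlan : Plan 7 7 0
heptadPlan =
  branch (# 0) []
  (branch (# 1) ((# 1 , # 0 , # 0 , # 1 , # 1) ∷ [])
  (branch (# 2) ((# 2 , # 0 , # 0 , # 2 , # 2) ∷ (# 1 , # 0 , # 0 , # 1 , # 1) ∷ [])
  (branch (# 3) ((# 3 , # 0 , # 1 , # 0 , # 2) ∷ (# 3 , # 0 , # 0 , # 3 , # 3) ∷ [])
  (branch (# 4) ((# 0 , # 1 , # 2 , # 3 , # 4) ∷ (# 3 , # 0 , # 4 , # 2 , # 4) ∷ [])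
  (branch (# 5) ((# 0 , # 2 , # 5 , # 3 , # 4) ∷ (# 5 , # 0 , # 4 , # 3 , # 4) ∷ [])
  (branch (# 6) ((# 0 , # 2 , # 6 , # 4 , # 5) ∷ (# 6 , # 0 , # 5 , # 4 , # 5) ∷ [])
  leaf))))))

heptadAnchors : Vec (Fin 7 × Fin 7 × Fin 7) 6
heptadAnchors =
    (# 0 , # 5 , # 6)
  ∷ (# 4 , # 5 , # 6)
  ∷ (# 3 , # 4 , # 5)
  ∷ (# 0 , # 4 , # 6)
  ∷ (# 6 , # 3 , # 5)
  ∷ (# 6 , # 4 , # 5)
  ∷ []

-- The three multispreads as unions of orbits

𝓐 : Multiset 5
𝓐 =
     orbit ((shift₁ , 2) ∷ (shiftω , 2) ∷ (scale , 3) ∷ (rotation , 5) ∷ [])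
       (row 1# 0# 0# 1# 1# ∷ row 0# 1# 0# 1# 0# ∷ row 0# 0# 1# 0# ω ∷ [])
  -- The planes joining the lines ℓₜ, t ∈ 𝔽₄ ∪ {∞}, to the point that is the image of the nucleus.
  ++ orbit ((rotation , 5) ∷ [])
       (row 0# 0# 1# 0# 0# ∷ row 0# 0# 0# 1# 0# ∷ row 0# 0# 0# 0# 1# ∷ [])
  -- The maps t ↦ at + b over 𝔽₄ act regularly on the elements of 𝔽₁₆ outside 𝔽₄, so this orbit is
  -- the set of conic lines.
  ++ orbit ((shift₁ , 2) ∷ (shiftω , 2) ∷ (scale , 3) ∷ [])
       (row 1# 0# 1# 0# 1# ∷ row 0# 1# ω ω 1# ∷ [])
  -- The remaining five lines ℓₜ, each contained in a plane of the second orbit and therefore not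
  -- distinguished.
  ++ orbit ((rotation , 5) ∷ [])
       (row 0# 0# 0# 1# 0# ∷ row 0# 0# 0# 0# 1# ∷ [])

𝓑 : Multiset 5
𝓑 =
     orbit ((rotation , 5) ∷ (reciprocal , 2) ∷ (twist , 4) ∷ [])
       (row 1# 0# 0# 0# 1# ∷ row 0# 1# 0# ω 0# ∷ row 0# 0# 1# 1# 0# ∷ [])
  ++ orbit ((rotation , 5) ∷ (twist , 4) ∷ [])
       (row 0# 1# 0# 0# 1# ∷ row 0# 0# 1# 0# ω ∷ row 0# 0# 0# 1# 1# ∷ [])
  ++ orbit ((rotation , 5) ∷ (twist , 2) ∷ [])
       (row 1# 0# 1# 0# 1# ∷ row 0# 1# 0# 0# 0# ∷ row 0# 0# 0# 1# 1# ∷ [])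
  ++ orbit ((rotation , 5) ∷ [])
       (row 1# 0# 0# 0# 0# ∷ row 0# 0# 0# 1# 0# ∷ row 0# 0# 0# 0# 1# ∷ [])
  ++ orbit ((rotation , 5) ∷ [])
       (row 1# 0# 0# 0# 0# ∷ row 0# 1# 0# 0# 0# ∷ row 0# 0# 1# ω² 0# ∷ [])
  ++ orbit ((twist , 4) ∷ [])
       (row 0# 1# 0# 0# 0# ∷ row 0# 0# 1# 0# 0# ∷ row 0# 0# 0# 0# 1# ∷ [])
  ++ orbit ((reciprocal , 2) ∷ [])
       (row 1# 0# 0# 0# ω² ∷ row 0# 1# 0# ω ω² ∷ row 0# 0# 1# 0# 0# ∷ [])
  ++ orbit ((rotation , 5) ∷ (reciprocal , 2) ∷ [])
       (row 1# 0# 1# 0# 1# ∷ row 0# 1# ω ω 1# ∷ [])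
  -- The lines ℓₜ with t² + ωt + 1 = 0, which `rotation` fixes and `twist` swaps; the previous orbit
  -- consists of the other ten conic lines.
  ++ orbit ((twist , 2) ∷ [])
       (row 1# 0# ω ω ω² ∷ row 0# 1# 0# 1# 1# ∷ [])

𝓒 : Multiset 5
𝓒 =
     orbit ((singer , 7) ∷ [])
       (row 0# 1# 0# 1# 0# ∷ row 0# 0# 1# ω² 0# ∷ row 0# 0# 0# 0# 1# ∷ [])
  ++ orbit ((singer , 7) ∷ [])
       (row 1# 0# 0# 1# 1# ∷ row 0# 1# 0# 0# ω ∷ row 0# 0# 1# ω 0# ∷ [])
  ++ orbit ((singer , 7) ∷ [])
       (row 1# 0# 0# 0# ω² ∷ row 0# 1# 0# ω² 0# ∷ row 0# 0# 1# 0# 0# ∷ [])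
  ++ orbit ((singer , 7) ∷ [])
       (row 1# 0# 0# ω 1# ∷ row 0# 1# 0# 0# ω ∷ row 0# 0# 1# 0# 0# ∷ [])
  ++ orbit ((singer , 7) ∷ [])
       (row 1# 0# 0# ω 1# ∷ row 0# 1# 0# 0# ω² ∷ row 0# 0# 1# 1# 0# ∷ [])
  ++ orbit ((singer , 7) ∷ [])
       (row 1# 0# 0# 0# 1# ∷ row 0# 1# 0# 0# ω² ∷ row 0# 0# 1# ω 0# ∷ [])
  ++ orbit ((singer , 7) ∷ [])
       (row 1# 0# 0# 1# 1# ∷ row 0# 1# 0# ω 0# ∷ row 0# 0# 1# 0# ω² ∷ [])
  ++ orbit ((singer , 7) ∷ [])
       (row 1# 0# 0# 1# ω² ∷ row 0# 1# 0# ω 0# ∷ row 0# 0# 1# 0# 1# ∷ [])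
  ++ orbit ((singer , 7) ∷ [])
       (row 1# 0# 0# 0# ω ∷ row 0# 1# 0# 1# 0# ∷ row 0# 0# 1# ω² 0# ∷ [])
  ++ orbit ((singer , 7) ∷ [])
       (row 1# 0# 0# ω² 0# ∷ row 0# 1# 0# 0# 1# ∷ row 0# 0# 1# 0# ω ∷ [])
  ++ orbit ((singer , 7) ∷ [])
       (row 1# 0# ω² 0# 0# ∷ row 0# 1# 0# 0# ω² ∷ row 0# 0# 0# 1# 0# ∷ [])
  ++ orbit ((singer , 7) ∷ [])
       (row 1# 0# ω² 0# 1# ∷ row 0# 1# 1# 0# 0# ∷ row 0# 0# 0# 1# ω² ∷ [])
  ++ orbit ((singer , 7) ∷ [])
       (row 1# 0# 0# 1# ω ∷ row 0# 1# 0# ω² 0# ∷ row 0# 0# 1# 0# 0# ∷ [])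
  ++ orbit ((singer , 7) ∷ [])
       (row 1# 0# 0# 0# ω ∷ row 0# 1# ω² 0# 0# ∷ row 0# 0# 0# 1# 1# ∷ [])
  ++ orbit ((singer , 7) ∷ [])
       (row 1# 0# ω 0# 1# ∷ row 0# 1# 0# 0# 0# ∷ row 0# 0# 0# 1# ω ∷ [])
  -- The summand 𝔽₆₄, which `singer` leaves invariant, is taken twice.
  ++ orbit []
       (row 1# 0# 0# 0# 0# ∷ row 0# 1# 0# 0# 0# ∷ row 0# 0# 1# 0# 0# ∷ [])
  ++ orbit []
       (row 1# 0# 0# 0# 0# ∷ row 0# 1# 0# 0# 0# ∷ row 0# 0# 1# 0# 0# ∷ [])
  ++ orbit ((singer , 7) ∷ [])
       (row 0# 1# 0# 1# 0# ∷ row 0# 0# 1# 0# 1# ∷ [])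

-- PGL(2,4) extended by the automorphisms of 𝔽₁₆, of order 240. The first three factors give the
-- stabiliser of ∞ in PGL(2,4), and `rotation`, of order 5, permutes 𝔽₄ ∪ {∞} regularly, so each
-- element is written exactly once.
conicGroup : List (SemilinearAut 5)
conicGroup = words ((shift₁ , 2) ∷ (shiftω , 2) ∷ (scale , 3) ∷ (rotation , 5) ∷ (conjugate , 4) ∷ [])

heptadGroup : List (SemilinearAut 5)
heptadGroup = words ((singer , 7) ∷ (squaring , 3) ∷ [])

-- Classification of the symmetries and orders of the groups

module Conic where
  open Lines conicLines public
  open Classification conicFrame conicGroup conicPlan conicAnchors public

  classify : ∀ f π → Permutes f π → Any (f ∼_) candidates
  classify = classification
    (witness anchors? refl)
    (witness (complete? table (List.map (λ h → images h base) conicGroup) conicPlan) refl)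

module Heptad where
  open Lines heptad public
  open Classification heptadFrame heptadGroup heptadPlan heptadAnchors public

  classify : ∀ f π → Permutes f π → Any (f ∼_) candidates
  classify = classification
    (witness anchors? refl)
    (witness (complete? table (List.map (λ h → images h base) heptadGroup) heptadPlan) refl)

automorphism : (f : SemilinearAut 5) (𝓢 : Multiset 5) →
               is-just (permutation? (List.map (image f) 𝓢) 𝓢) ≡ true → Automorphism 𝓢
automorphism f 𝓢 eq = record
  { map       = f
  ; preserves = to-witness-T (permutation? (List.map (image f) 𝓢) 𝓢) (subst T (sym eq) tt) }

-- PGL(2,4) together with `conjugate²`, which sends t to t⁴ and has order 2: there are 60 · 2 = 120
-- words.
generators𝓐 : List (Automorphism 𝓐 × ℕ)
generators𝓐 =
    (automorphism shift₁ 𝓐 refl , 2)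
  ∷ (automorphism shiftω 𝓐 refl , 2)
  ∷ (automorphism scale 𝓐 refl , 3)
  ∷ (automorphism rotation 𝓐 refl , 5)
  ∷ (automorphism conjugate² 𝓐 refl , 2)
  ∷ []

generators𝓑 : List (Automorphism 𝓑 × ℕ)
generators𝓑 =
    (automorphism rotation 𝓑 refl , 5)
  ∷ (automorphism reciprocal 𝓑 refl , 2)
  ∷ (automorphism twist 𝓑 refl , 4)
  ∷ []

generators𝓒 : List (Automorphism 𝓒 × ℕ)
generators𝓒 = (automorphism singer 𝓒 refl , 7) ∷ []

order-𝓐 : HasOrder (Aut 𝓐) 120
order-𝓐 = order Conic.candidates (witness (accounts? Conic.candidates) refl) λ f f-preserves →
  let π , permutes = permutesLines (witness isDistinguished? refl) f f-preserves in
  Conic.classify f π permutes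
  where
  open Distinguished conicLines 𝓐
  open Order 𝓐 generators𝓐

order-𝓑 : HasOrder (Aut 𝓑) 40
order-𝓑 = order Conic.candidates (witness (accounts? Conic.candidates) refl) λ f f-preserves →
  let π , permutes = permutesLines (witness isDistinguished? refl) f f-preserves in
  Conic.classify f π permutes
  where
  open Distinguished conicLines 𝓑
  open Order 𝓑 generators𝓑

order-𝓒 : HasOrder (Aut 𝓒) 7
order-𝓒 = order Heptad.candidates (witness (accounts? Heptad.candidates) refl) λ f f-preserves →
  let π , permutes = permutesLines (witness isDistinguished? refl) f f-preserves in
  Heptad.classify f π permutes
  where
  open Distinguished heptad 𝓒
  open Order 𝓒 generators𝓒

mainTheorem7 : (∃ λ (𝓢 : Multiset 5) →
    All (λ S → dim S ≡ 2 ⊎ dim S ≡ 3) 𝓢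
    × #ofDim 2 𝓢 ≡ 17
    × #ofDim 3 𝓢 ≡ 65
    × ((H : Subspace 5) → IsHyperplane H → #containedIn H 𝓢 ≡ 2)
    × IsMultispread 51 5 3 5 𝓢
    × HasOrder (Aut 𝓢) 120)
    ×
    (∃ λ (𝓢 : Multiset 5) →
    All (λ S → dim S ≡ 2 ⊎ dim S ≡ 3) 𝓢
    × #ofDim 2 𝓢 ≡ 12
    × #ofDim 3 𝓢 ≡ 86
    × ((H : Subspace 5) → IsHyperplane H → #containedIn H 𝓢 ≡ 2)
    × IsMultispread 36 6 3 5 𝓢
    × HasOrder (Aut 𝓢) 40)
    ×
    (∃ λ (𝓢 : Multiset 5) →
    All (λ S → dim S ≡ 2 ⊎ dim S ≡ 3) 𝓢
    × #ofDim 2 𝓢 ≡ 7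
    × #ofDim 3 𝓢 ≡ 107
    × ((H : Subspace 5) → IsHyperplane H → #containedIn H 𝓢 ≡ 2)
    × IsMultispread 21 7 3 5 𝓢
    × HasOrder (Aut 𝓢) 7)
mainTheorem7 =
    ( 𝓐 , witness (dims? 𝓐) refl , refl , refl
    , hyperplaneCount⇒#containedIn 𝓐 (witness (hyperplaneCount? 2 𝓐) refl)
    , witness (isMultispread? 51 5 3 𝓐) refl , order-𝓐 )
  , ( 𝓑 , witness (dims? 𝓑) refl , refl , refl
    , hyperplaneCount⇒#containedIn 𝓑 (witness (hyperplaneCount? 2 𝓑) refl)
    , witness (isMultispread? 36 6 3 𝓑) refl , order-𝓑 )
  , ( 𝓒 , witness (dims? 𝓒) refl , refl , refl
    , hyperplaneCount⇒#containedIn 𝓒 (witness (hyperplaneCount? 2 𝓒) refl)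
    , witness (isMultispread? 21 7 3 𝓒) refl , order-𝓒 )
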